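{- For all integers $j\ge k\ge 1$, there exist two half-regular bipartite graphs $\mathcal{F}_{j,k}$ and $\mathcal{F}_{j,k}'$ that have the same spectrum, the same degree sequences and the same girth $4k+2$, such that each of them has exactly one $(4k+2)$-cycle, and for every even integer $\ell$ with $4k+2<\ell\le 4j+6$ the number of $\ell$-cycles in $\mathcal{F}_{j,k}$ is different from the number of $\ell$-cycles in $\mathcal{F}_{j,k}'$.
   Context: All graphs are finite, simple and undirected, and may be disconnected. The spectrum of a graph is the multiset of eigenvalues of its adjacency matrix. The degree sequences of a bipartite graph are the two monotonic non-increasing sequences of the node degrees on the two sides of a bipartition; two graphs have the same degree sequences if these coincide for suitable bipartitions. A bipartite graph is bi-regular if all nodes on the same side have the same degree, and irregular if it is not bi-regular. It is half-regular if all nodes on one side of the bipartition have the same degree. Half-regular graphs are regarded as a special case of irregular graphs, so here "half-regular" means half-regular and not bi-regular. An $\ell$-cycle is a cycle of length $\ell$, cycles being counted as subgraphs. The girth is the length of a shortest cycle. -}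

module Defs where

open import Algebra.Bundles using (CommutativeRing)
open import Algebra.Structures using (IsCommutativeRing)
open import Data.Bool.Base using (Bool; true; false; if_then_else_; T)
open import Data.Bool.Properties using () renaming (_≟_ to _≟ᵇ_)
open import Data.Fin.Base using (Fin; toℕ)
open import Data.List.Base using (List; length; map; filter; filterᵇ; allFin)
open import Data.List.Sort using (sort)
open import Data.Nat.Base as ℕ using (ℕ; suc)
import Data.Nat.Properties as ℕₚ
open import Data.Product.Base using (∃; ∃₂; _×_; _,_)
open import Data.Rational.Base as ℚ using (ℚ; 0ℚ; 1ℚ; ½)
import Data.Rational.Properties as ℚₚ
import Data.Rational.Solver as ℚ-Solver
open import Data.Sum.Base using (_⊎_)
open import Data.Vec.Functional using (Vector)
open import Function.Bundles using (Bijection; _⇔_)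
open import Function.Definitions using (Injective)
import Function.Properties.Equivalence as Equivalence
open import Level using (0ℓ)
open import Relation.Binary.Bundles using (Setoid; DecTotalOrder)
import Relation.Binary.Construct.Flip.EqAndOrd as Flip
open import Relation.Binary.PropositionalEquality
  using (_≡_; _≢_; refl; sym; trans; cong; subst)
import Relation.Binary.PropositionalEquality.Properties as ≡ₚ
open import Relation.Nullary using (¬_)

------------------------------------------------------------------------
-- Real numbers, as Cauchy sequences of rationals up to a null difference

Cauchy : (ℕ → ℚ) → Set
Cauchy f = ∀ ε → 0ℚ ℚ.< ε →
  ∃ λ N → ∀ m n → N ℕ.≤ m → N ℕ.≤ n → ℚ.∣ f m ℚ.- f n ∣ ℚ.< ε

record ℝ : Set where
  no-eta-equality
  field
    seq    : ℕ → ℚ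
    cauchy : Cauchy seq

open ℝ public

infix 4 _≃_

-- A record, so that the two reals can be inferred from a proof.
record _≃_ (x y : ℝ) : Set where
  constructor mk≃
  field
    close : ∀ ε → 0ℚ ℚ.< ε →
      ∃ λ N → ∀ n → N ℕ.≤ n → ℚ.∣ seq x n ℚ.- seq y n ∣ ℚ.< ε

open _≃_ public

private
  open ℚ-Solver.+-*-Solver using (solve; _:+_; _:*_; _:-_; :-_; _:=_)

  ∣p-p∣≡0 : ∀ p → ℚ.∣ p ℚ.- p ∣ ≡ 0ℚ
  ∣p-p∣≡0 p = cong ℚ.∣_∣ (ℚₚ.+-inverseʳ p)

  ∣p-q∣≡∣q-p∣ : ∀ p q → ℚ.∣ p ℚ.- q ∣ ≡ ℚ.∣ q ℚ.- p ∣
  ∣p-q∣≡∣q-p∣ p q = trans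
    (cong ℚ.∣_∣ (solve 2 (λ p q → p :- q := :- (q :- p)) refl p q))
    (ℚₚ.∣-p∣≡∣p∣ (q ℚ.- p))

  half-pos : ∀ {ε} → 0ℚ ℚ.< ε → 0ℚ ℚ.< ½ ℚ.* ε
  half-pos {ε} 0<ε = subst (ℚ._< ½ ℚ.* ε) (ℚₚ.*-zeroʳ ½) (ℚₚ.*-monoʳ-<-pos ½ 0<ε)

  half+half : ∀ ε → ½ ℚ.* ε ℚ.+ ½ ℚ.* ε ≡ ε
  half+half ε = trans (sym (ℚₚ.*-distribʳ-+ ε ½ ½)) (ℚₚ.*-identityˡ ε)

  sum-small : ∀ {ε} p q → ℚ.∣ p ∣ ℚ.< ½ ℚ.* ε → ℚ.∣ q ∣ ℚ.< ½ ℚ.* ε →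
              ℚ.∣ p ℚ.+ q ∣ ℚ.< ε
  sum-small {ε} p q p<ε q<ε = ℚₚ.≤-<-trans (ℚₚ.∣p+q∣≤∣p∣+∣q∣ p q)
    (subst (ℚ.∣ p ∣ ℚ.+ ℚ.∣ q ∣ ℚ.<_) (half+half ε) (ℚₚ.+-mono-< p<ε q<ε))

  product-small : ∀ B ε → 0ℚ ℚ.< B → 0ℚ ℚ.< ε →
    ∃ λ δ → 0ℚ ℚ.< δ ×
      (∀ p q → ℚ.∣ p ∣ ℚ.≤ B → ℚ.∣ q ∣ ℚ.< δ → ℚ.∣ p ℚ.* q ∣ ℚ.< ε)
  product-small B ε 0<B 0<ε = δ , 0<δ , small
    where
    instance
      posB = ℚ.positive 0<B
      nzB  = ℚₚ.pos⇒nonZero B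
      pos⁻¹ = ℚₚ.1/pos⇒pos B

    δ = ℚ.1/ B ℚ.* ε

    0<δ : 0ℚ ℚ.< δ
    0<δ = subst (ℚ._< δ) (ℚₚ.*-zeroʳ (ℚ.1/ B)) (ℚₚ.*-monoʳ-<-pos (ℚ.1/ B) 0<ε)

    Bδ≡ε : B ℚ.* δ ≡ ε
    Bδ≡ε = trans (sym (ℚₚ.*-assoc B (ℚ.1/ B) ε))
             (trans (cong (ℚ._* ε) (ℚₚ.*-inverseʳ B)) (ℚₚ.*-identityˡ ε))

    small : ∀ p q → ℚ.∣ p ∣ ℚ.≤ B → ℚ.∣ q ∣ ℚ.< δ → ℚ.∣ p ℚ.* q ∣ ℚ.< ε
    small p q p≤B q<δ =
      subst (ℚ._< ε) (sym (ℚₚ.∣p*q∣≡∣p∣*∣q∣ p q))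
        (ℚₚ.≤-<-trans
          (ℚₚ.*-monoʳ-≤-nonNeg ℚ.∣ q ∣ {{ℚₚ.∣-∣-nonNeg q}} p≤B)
          (subst (B ℚ.* ℚ.∣ q ∣ ℚ.<_) Bδ≡ε (ℚₚ.*-monoʳ-<-pos B q<δ)))

  bounded : ∀ {f} → Cauchy f →
    ∃ λ B → 0ℚ ℚ.< B × ∃ λ N → ∀ n → N ℕ.≤ n → ℚ.∣ f n ∣ ℚ.≤ B
  bounded {f} cf with cf 1ℚ (ℚₚ.positive⁻¹ 1ℚ)
  ... | N , near = ℚ.∣ f N ∣ ℚ.+ 1ℚ
    , ℚₚ.+-mono-≤-< (ℚₚ.0≤∣p∣ (f N)) (ℚₚ.positive⁻¹ 1ℚ)
    , N
    , λ n N≤n → subst (λ z → ℚ.∣ z ∣ ℚ.≤ ℚ.∣ f N ∣ ℚ.+ 1ℚ)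
        (solve 2 (λ a b → a :+ (b :- a) := b) refl (f N) (f n))
        (ℚₚ.≤-trans (ℚₚ.∣p+q∣≤∣p∣+∣q∣ (f N) (f n ℚ.- f N))
          (ℚₚ.+-monoʳ-≤ ℚ.∣ f N ∣ (ℚₚ.<⇒≤ (near n N N≤n ℕₚ.≤-refl))))

  sum-difference : ∀ a b c d →
    (a ℚ.- c) ℚ.+ (b ℚ.- d) ≡ (a ℚ.+ b) ℚ.- (c ℚ.+ d)
  sum-difference = solve 4 (λ a b c d → (a :- c) :+ (b :- d) := (a :+ b) :- (c :+ d)) refl

  product-difference : ∀ a b c d →
    a ℚ.* (b ℚ.- d) ℚ.+ d ℚ.* (a ℚ.- c) ≡ a ℚ.* b ℚ.- c ℚ.* d
  product-difference =
    solve 4 (λ a b c d → a :* (b :- d) :+ d :* (a :- c) := a :* b :- c :* d) refl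

  neg-difference : ∀ a c → ℚ.∣ ℚ.- a ℚ.- ℚ.- c ∣ ≡ ℚ.∣ a ℚ.- c ∣
  neg-difference a c = trans
    (cong ℚ.∣_∣ (solve 2 (λ a c → (:- a) :- (:- c) := :- (a :- c)) refl a c))
    (ℚₚ.∣-p∣≡∣p∣ (a ℚ.- c))

fromℚ : ℚ → ℝ
seq    (fromℚ q) _ = q
cauchy (fromℚ q) ε 0<ε =
  0 , λ _ _ _ _ → subst (ℚ._< ε) (sym (∣p-p∣≡0 q)) 0<ε

0ℝ 1ℝ : ℝ
0ℝ = fromℚ 0ℚ
1ℝ = fromℚ 1ℚ

infixl 6 _+ℝ_
infixl 7 _*ℝ_
infix  8 -ℝ_

_+ℝ_ : ℝ → ℝ → ℝ
seq    (x +ℝ y) n = seq x n ℚ.+ seq y n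
cauchy (x +ℝ y) ε 0<ε =
  let f = seq x
      g = seq y
      N₁ , p₁ = cauchy x (½ ℚ.* ε) (half-pos 0<ε)
      N₂ , p₂ = cauchy y (½ ℚ.* ε) (half-pos 0<ε)
  in N₁ ℕ.⊔ N₂ , λ m n N≤m N≤n →
     subst (λ z → ℚ.∣ z ∣ ℚ.< ε) (sum-difference (f m) (g m) (f n) (g n))
       (sum-small (f m ℚ.- f n) (g m ℚ.- g n)
         (p₁ m n (ℕₚ.m⊔n≤o⇒m≤o N₁ N₂ N≤m) (ℕₚ.m⊔n≤o⇒m≤o N₁ N₂ N≤n))
         (p₂ m n (ℕₚ.m⊔n≤o⇒n≤o N₁ N₂ N≤m) (ℕₚ.m⊔n≤o⇒n≤o N₁ N₂ N≤n)))

-ℝ_ : ℝ → ℝ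
seq    (-ℝ x) n = ℚ.- seq x n
cauchy (-ℝ x) ε 0<ε =
  let f = seq x
      N , p = cauchy x ε 0<ε
  in N , λ m n N≤m N≤n →
     subst (ℚ._< ε) (sym (neg-difference (f m) (f n))) (p m n N≤m N≤n)

_*ℝ_ : ℝ → ℝ → ℝ
seq    (x *ℝ y) n = seq x n ℚ.* seq y n
cauchy (x *ℝ y) ε 0<ε =
  let f = seq x
      g = seq y
      B₁ , 0<B₁ , M₁ , b₁ = bounded (cauchy x)
      B₂ , 0<B₂ , M₂ , b₂ = bounded (cauchy y)
      δ₁ , 0<δ₁ , s₁ = product-small B₁ (½ ℚ.* ε) 0<B₁ (half-pos 0<ε)
      δ₂ , 0<δ₂ , s₂ = product-small B₂ (½ ℚ.* ε) 0<B₂ (half-pos 0<ε)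
      N₁ , p₁ = cauchy y δ₁ 0<δ₁
      N₂ , p₂ = cauchy x δ₂ 0<δ₂
      M = M₁ ℕ.⊔ M₂
      N = N₁ ℕ.⊔ N₂
  in M ℕ.⊔ N , λ m n ≤m ≤n →
     let M≤m = ℕₚ.m⊔n≤o⇒m≤o M N ≤m
         N≤m = ℕₚ.m⊔n≤o⇒n≤o M N ≤m
         M≤n = ℕₚ.m⊔n≤o⇒m≤o M N ≤n
         N≤n = ℕₚ.m⊔n≤o⇒n≤o M N ≤n
     in subst (λ z → ℚ.∣ z ∣ ℚ.< ε) (product-difference (f m) (g m) (f n) (g n))
       (sum-small (f m ℚ.* (g m ℚ.- g n)) (g n ℚ.* (f m ℚ.- f n))
         (s₁ (f m) (g m ℚ.- g n) (b₁ m (ℕₚ.m⊔n≤o⇒m≤o M₁ M₂ M≤m))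
           (p₁ m n (ℕₚ.m⊔n≤o⇒m≤o N₁ N₂ N≤m) (ℕₚ.m⊔n≤o⇒m≤o N₁ N₂ N≤n)))
         (s₂ (g n) (f m ℚ.- f n) (b₂ n (ℕₚ.m⊔n≤o⇒n≤o M₁ M₂ M≤n))
           (p₂ m n (ℕₚ.m⊔n≤o⇒n≤o N₁ N₂ N≤m) (ℕₚ.m⊔n≤o⇒n≤o N₁ N₂ N≤n))))

≃-pointwise : ∀ {x y} → (∀ n → seq x n ≡ seq y n) → x ≃ y
≃-pointwise {x} {y} eq = mk≃ λ ε 0<ε → 0 , λ n _ →
  subst (ℚ._< ε)
    (trans (sym (∣p-p∣≡0 (seq x n))) (cong (λ z → ℚ.∣ seq x n ℚ.- z ∣) (eq n))) 0<ε

private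
  ≃-refl : ∀ {x} → x ≃ x
  ≃-refl = ≃-pointwise λ _ → refl

  ≃-sym : ∀ {x y} → x ≃ y → y ≃ x
  ≃-sym {x} {y} (mk≃ p) = mk≃ λ ε 0<ε → let N , q = p ε 0<ε in N , λ n N≤n →
    subst (ℚ._< ε) (∣p-q∣≡∣q-p∣ (seq x n) (seq y n)) (q n N≤n)

  ≃-trans : ∀ {x y z} → x ≃ y → y ≃ z → x ≃ z
  ≃-trans {x} {y} {z} (mk≃ p) (mk≃ q) = mk≃ λ ε 0<ε →
    let N₁ , p₁ = p (½ ℚ.* ε) (half-pos 0<ε)
        N₂ , p₂ = q (½ ℚ.* ε) (half-pos 0<ε)
    in N₁ ℕ.⊔ N₂ , λ n N≤n →
       subst (λ d → ℚ.∣ d ∣ ℚ.< ε)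
         (solve 3 (λ a b c → (a :- b) :+ (b :- c) := a :- c) refl (seq x n) (seq y n) (seq z n))
         (sum-small (seq x n ℚ.- seq y n) (seq y n ℚ.- seq z n)
           (p₁ n (ℕₚ.m⊔n≤o⇒m≤o N₁ N₂ N≤n)) (p₂ n (ℕₚ.m⊔n≤o⇒n≤o N₁ N₂ N≤n)))

  +ℝ-cong : ∀ {x y u v} → x ≃ y → u ≃ v → x +ℝ u ≃ y +ℝ v
  +ℝ-cong {x} {y} {u} {v} (mk≃ p) (mk≃ q) = mk≃ λ ε 0<ε →
    let N₁ , p₁ = p (½ ℚ.* ε) (half-pos 0<ε)
        N₂ , p₂ = q (½ ℚ.* ε) (half-pos 0<ε)
    in N₁ ℕ.⊔ N₂ , λ n N≤n →
       subst (λ d → ℚ.∣ d ∣ ℚ.< ε)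
         (sum-difference (seq x n) (seq u n) (seq y n) (seq v n))
         (sum-small (seq x n ℚ.- seq y n) (seq u n ℚ.- seq v n)
           (p₁ n (ℕₚ.m⊔n≤o⇒m≤o N₁ N₂ N≤n)) (p₂ n (ℕₚ.m⊔n≤o⇒n≤o N₁ N₂ N≤n)))

  -ℝ-cong : ∀ {x y} → x ≃ y → -ℝ x ≃ -ℝ y
  -ℝ-cong {x} {y} (mk≃ p) = mk≃ λ ε 0<ε → let N , q = p ε 0<ε in N , λ n N≤n →
    subst (ℚ._< ε) (sym (neg-difference (seq x n) (seq y n))) (q n N≤n)

  *ℝ-cong : ∀ {x y u v} → x ≃ y → u ≃ v → x *ℝ u ≃ y *ℝ v
  *ℝ-cong {x} {y} {u} {v} (mk≃ p) (mk≃ q) = mk≃ λ ε 0<ε →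
    let B₁ , 0<B₁ , M₁ , b₁ = bounded (cauchy x)
        B₂ , 0<B₂ , M₂ , b₂ = bounded (cauchy v)
        δ₁ , 0<δ₁ , s₁ = product-small B₁ (½ ℚ.* ε) 0<B₁ (half-pos 0<ε)
        δ₂ , 0<δ₂ , s₂ = product-small B₂ (½ ℚ.* ε) 0<B₂ (half-pos 0<ε)
        N₁ , p₁ = q δ₁ 0<δ₁
        N₂ , p₂ = p δ₂ 0<δ₂
        M = M₁ ℕ.⊔ M₂
        N = N₁ ℕ.⊔ N₂
    in M ℕ.⊔ N , λ n ≤n →
       let M≤n = ℕₚ.m⊔n≤o⇒m≤o M N ≤n
           N≤n = ℕₚ.m⊔n≤o⇒n≤o M N ≤n
       in subst (λ z → ℚ.∣ z ∣ ℚ.< ε)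
         (product-difference (seq x n) (seq u n) (seq y n) (seq v n))
         (sum-small (seq x n ℚ.* (seq u n ℚ.- seq v n)) (seq v n ℚ.* (seq x n ℚ.- seq y n))
           (s₁ (seq x n) (seq u n ℚ.- seq v n) (b₁ n (ℕₚ.m⊔n≤o⇒m≤o M₁ M₂ M≤n))
             (p₁ n (ℕₚ.m⊔n≤o⇒m≤o N₁ N₂ N≤n)))
           (s₂ (seq v n) (seq x n ℚ.- seq y n) (b₂ n (ℕₚ.m⊔n≤o⇒n≤o M₁ M₂ M≤n))
             (p₂ n (ℕₚ.m⊔n≤o⇒n≤o N₁ N₂ N≤n))))

  isCommutativeRing : IsCommutativeRing _≃_ _+ℝ_ _*ℝ_ -ℝ_ 0ℝ 1ℝ
  isCommutativeRing = record
    { isRing = record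
      { +-isAbelianGroup = record
        { isGroup = record
          { isMonoid = record
            { isSemigroup = record
              { isMagma = record
                { isEquivalence = record { refl = ≃-refl ; sym = ≃-sym ; trans = ≃-trans }
                ; ∙-cong = +ℝ-cong
                }
              ; assoc = λ x y z → ≃-pointwise λ n → ℚₚ.+-assoc (seq x n) (seq y n) (seq z n)
              }
            ; identity = (λ x → ≃-pointwise λ n → ℚₚ.+-identityˡ (seq x n))
                       , (λ x → ≃-pointwise λ n → ℚₚ.+-identityʳ (seq x n))
            }
          ; inverse = (λ x → ≃-pointwise λ n → ℚₚ.+-inverseˡ (seq x n))
                    , (λ x → ≃-pointwise λ n → ℚₚ.+-inverseʳ (seq x n))
          ; ⁻¹-cong = -ℝ-cong
          }
        ; comm = λ x y → ≃-pointwise λ n → ℚₚ.+-comm (seq x n) (seq y n)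
        }
      ; *-cong = *ℝ-cong
      ; *-assoc = λ x y z → ≃-pointwise λ n → ℚₚ.*-assoc (seq x n) (seq y n) (seq z n)
      ; *-identity = (λ x → ≃-pointwise λ n → ℚₚ.*-identityˡ (seq x n))
                   , (λ x → ≃-pointwise λ n → ℚₚ.*-identityʳ (seq x n))
      ; distrib = (λ x y z → ≃-pointwise λ n → ℚₚ.*-distribˡ-+ (seq x n) (seq y n) (seq z n))
                , (λ x y z → ≃-pointwise λ n → ℚₚ.*-distribʳ-+ (seq x n) (seq y n) (seq z n))
      }
    ; *-comm = λ x y → ≃-pointwise λ n → ℚₚ.*-comm (seq x n) (seq y n)
    }

ℝ-commutativeRing : CommutativeRing 0ℓ 0ℓ
ℝ-commutativeRing = record { isCommutativeRing = isCommutativeRing }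

open import Algebra.Properties.CommutativeMonoid.Sum
  (CommutativeRing.+-commutativeMonoid ℝ-commutativeRing) public
  using () renaming (sum to sumℝ)

------------------------------------------------------------------------
-- Eigenvalues of real matrices

Matrix : ℕ → Set
Matrix n = Fin n → Fin n → ℝ

infix 4 _≋_

_≋_ : ∀ {n} → Vector ℝ n → Vector ℝ n → Set
v ≋ w = ∀ i → v i ≃ w i

_·ᵥ_ : ∀ {n} → Matrix n → Vector ℝ n → Vector ℝ n
(A ·ᵥ v) i = sumℝ λ j → A i j *ℝ v j

-- Membership in the eigenspace of lam, which contains the zero vector.
InEigenspace : ∀ {n} → Matrix n → ℝ → Vector ℝ n → Set
InEigenspace A lam v = A ·ᵥ v ≋ λ i → lam *ℝ v i

combination : ∀ {m n} → Vector ℝ m → (Fin m → Vector ℝ n) → Vector ℝ n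
combination c b i = sumℝ λ k → c k *ℝ b k i

LinearlyIndependent : ∀ {m n} → (Fin m → Vector ℝ n) → Set
LinearlyIndependent b =
  ∀ c → combination c b ≋ (λ _ → 0ℝ) → c ≋ (λ _ → 0ℝ)

-- lam occurs exactly m times among the eigenvalues of A, i.e. its eigenspace
-- has a basis of m vectors; m = 0 means that lam is not an eigenvalue.  For
-- the symmetric matrices considered here, geometric and algebraic
-- multiplicities agree.
HasMultiplicity : ∀ {n} → Matrix n → ℝ → ℕ → Set
HasMultiplicity {n} A lam m = ∃ λ (b : Fin m → Vector ℝ n) →
  (∀ k → InEigenspace A lam (b k)) ×
  LinearlyIndependent b ×
  (∀ v → InEigenspace A lam v → ∃ λ c → v ≋ combination c b)

------------------------------------------------------------------------
-- Graphs

record Graph : Set where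
  field
    order       : ℕ
    adj         : Fin order → Fin order → Bool
    symmetric   : ∀ u v → adj u v ≡ adj v u
    irreflexive : ∀ v → adj v v ≡ false

  Vertex : Set
  Vertex = Fin order

  Adjacent : Vertex → Vertex → Set
  Adjacent u v = T (adj u v)

  degree : Vertex → ℕ
  degree v = length (filterᵇ (adj v) (allFin order))

  adjacencyMatrix : Matrix order
  adjacencyMatrix u v = if adj u v then 1ℝ else 0ℝ

open Graph public

-- Equality of multisets of reals, as equality of all multiplicities.
SameSpectrum : Graph → Graph → Set
SameSpectrum G H = ∀ lam m →
  HasMultiplicity (adjacencyMatrix G) lam m ⇔ HasMultiplicity (adjacencyMatrix H) lam m

record Bipartition (G : Graph) : Set where
  field
    side   : Vertex G → Bool
    proper : ∀ u v → Adjacent G u v → side u ≢ side v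

open Bipartition public

≥-decTotalOrder : DecTotalOrder 0ℓ 0ℓ 0ℓ
≥-decTotalOrder = Flip.decTotalOrder ℕₚ.≤-decTotalOrder

-- Non-increasing, since the order used for sorting is _≥_.
degreeSequence : (G : Graph) → Bipartition G → Bool → List ℕ
degreeSequence G P s =
  sort ≥-decTotalOrder (map (degree G) (filter (λ v → side P v ≟ᵇ s) (allFin (order G))))

SameDegreeSequences : Graph → Graph → Set
SameDegreeSequences G H = ∃₂ λ (P : Bipartition G) (Q : Bipartition H) →
  ∀ s → degreeSequence G P s ≡ degreeSequence H Q s

RegularOn : (G : Graph) → Bipartition G → Bool → Set
RegularOn G P s = ∃ λ d → ∀ v → side P v ≡ s → degree G v ≡ d

BiRegular : Graph → Set
BiRegular G = ∃ λ (P : Bipartition G) → ∀ s → RegularOn G P s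

-- Bi-regular graphs are excluded, for every choice of bipartition.
HalfRegular : Graph → Set
HalfRegular G = (∃₂ λ (P : Bipartition G) s → RegularOn G P s) × ¬ BiRegular G

------------------------------------------------------------------------
-- Cycles

-- j follows i in the cyclic order 0, 1, …, ℓ-1, 0.
Next : ∀ {ℓ} → Fin ℓ → Fin ℓ → Set
Next {ℓ} i j = (toℕ j ≡ suc (toℕ i)) ⊎ (suc (toℕ i) ≡ ℓ × toℕ j ≡ 0)

record Cycle (G : Graph) (ℓ : ℕ) : Set where
  field
    3≤length : 3 ℕ.≤ ℓ
    vertex   : Fin ℓ → Vertex G
    distinct : Injective _≡_ _≡_ vertex
    adjacent : ∀ i j → Next i j → Adjacent G (vertex i) (vertex j)

open Cycle public

EdgeOf : ∀ {G ℓ} → Cycle G ℓ → Vertex G → Vertex G → Set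
EdgeOf C u v = ∃₂ λ i j → Next i j ×
  ((u ≡ vertex C i × v ≡ vertex C j) ⊎ (u ≡ vertex C j × v ≡ vertex C i))

-- Cycles are identified when they are the same subgraph, so the starting
-- point and the direction of traversal are forgotten.  Comparing edges is
-- enough because a cycle has no isolated vertices.
cycleSetoid : Graph → ℕ → Setoid 0ℓ 0ℓ
cycleSetoid G ℓ = record
  { Carrier       = Cycle G ℓ
  ; _≈_           = λ C D → ∀ u v → EdgeOf C u v ⇔ EdgeOf D u v
  ; isEquivalence = record
    { refl  = λ _ _ → Equivalence.refl
    ; sym   = λ p u v → Equivalence.sym (p u v)
    ; trans = λ p q u v → Equivalence.trans (p u v) (q u v)
    }
  }

NumberOfCycles : Graph → ℕ → ℕ → Set
NumberOfCycles G ℓ m = Bijection (≡ₚ.setoid (Fin m)) (cycleSetoid G ℓ)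

HasGirth : Graph → ℕ → Set
HasGirth G g = Cycle G g × (∀ ℓ → Cycle G ℓ → g ℕ.≤ ℓ)

DifferentNumberOfCycles : Graph → Graph → ℕ → Set
DifferentNumberOfCycles G H ℓ = ∃₂ λ m n →
  NumberOfCycles G ℓ m × NumberOfCycles H ℓ n × m ≢ n

{-# OPTIONS --safe #-}
module Submission where

-- Subdividing every edge of a graph makes one side of a bipartition have all
-- degrees 2.  Take several copies of a path with an even number H of edges and
-- join ends of copies through new vertices of degree 2.  Two such wirings have
-- similar adjacency matrices as soon as invertible matrices, one acting on the
-- copies and one on the new vertices, carry the incidence matrices of one
-- wiring to those of the other.  This happens
-- * for three copies joined in a triangle next to an isolated copy, with one
--   cycle, of length 2H + 6, and the tree in which three copies are joined to
--   a fourth one;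
-- * for two copies joined at both ends next to two pairs of copies joined at
--   one end, with one cycle, of length 2H + 4, and four copies joined in a
--   ring next to two isolated copies, with one cycle, of length 4H + 8.
-- Start from a cycle of length 4k + 2 next to a path, for both graphs, and go
-- through the even lengths in increasing order: if the two graphs have equally
-- many cycles of length 2u, add the two sides of the first pair (u odd) or of
-- the second pair (u even) with its cycle of length 2u.  This changes none of
-- the numbers of shorter cycles.

open import Defs
open import Algebra.Bundles using (CommutativeRing)
open import Data.Bool.Base using (Bool; true; false; if_then_else_; not; T; _∨_)
open import Data.Bool.Properties using (T?; ¬-not; not-¬; not-involutive) renaming (_≟_ to _≟ᵇ_)
open import Data.Empty using (⊥-elim)
open import Data.Fin.Base using (Fin; zero; suc; toℕ; fromℕ; fromℕ<; inject₁; opposite)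
open import Data.Fin.Patterns
import Data.Fin.Properties as Finₚ
open import Data.Integer.Base as Integer using (ℤ)
open import Data.List.Base using (List; []; _∷_; _++_; map; length; foldr; filter; filterᵇ; concat; allFin; tabulate)
open import Data.List.Properties
  using (map-++; map-∘; map-cong; length-map; length-++; length-tabulate; map-tabulate; ++-identityʳ)
import Data.List.Membership.DecPropositional as DecMembership
open import Data.List.Membership.Propositional using (_∈_)
open import Data.List.Membership.Propositional.Properties
open import Data.List.Membership.Propositional.Properties.WithK using (unique∧set⇒bag)
open import Data.List.Relation.Binary.BagAndSetEquality using (∼bag⇒↭)
open import Data.List.Relation.Binary.Permutation.Propositional using (_↭_; ↭-sym; ↭-trans; ↭⇒↭ₛ)
open import Data.List.Relation.Binary.Permutation.Propositional.Properties using (↭-length)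
  renaming (map⁺ to ↭-map⁺)
open import Data.List.Relation.Binary.Pointwise using (Pointwise-≡⇒≡)
open import Data.List.Relation.Unary.All as All using ([]; _∷_)
import Data.List.Relation.Unary.All.Properties as Allₚ
open import Data.List.Relation.Unary.AllPairs as AllPairs using ([]; _∷_)
import Data.List.Relation.Unary.AllPairs.Properties as AllPairsₚ
open import Data.List.Relation.Unary.Any using (here; there)
open import Data.List.Relation.Unary.Sorted.TotalOrder.Properties using (↗↭↗⇒≋)
open import Data.List.Relation.Unary.Unique.Propositional using (Unique)
import Data.List.Relation.Unary.Unique.DecPropositional as DecUnique
import Data.List.Relation.Unary.Unique.Propositional.Properties as Unique
open import Data.List.Sort ≥-decTotalOrder using (sort; sort-↭; sort-↗)
open import Data.Nat.Base using (ℕ; zero; suc; _+_; _*_; _∸_; _≤_; _<_; z≤n; s≤s; NonZero)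
open import Data.Nat.Divisibility using (_∣_; divides)
open import Data.Nat.ListAction using (sum)
import Data.Nat.Properties as ℕₚ
open import Data.Nat.Tactic.RingSolver using (solve-∀)
open import Data.Product.Base using (∃; ∃₂; _×_; _,_; proj₁; proj₂)
open import Data.Product.Properties using () renaming (≡-dec to ×-≡-dec)
open import Data.Rational.Base as ℚ using (ℚ; 0ℚ; 1ℚ)
import Data.Rational.Properties as ℚₚ
open import Data.Sum.Base as Sum using (_⊎_; inj₁; inj₂)
open import Data.Sum.Function.Propositional using (_⊎-↔_)
open import Data.Sum.Properties using (inj₁-injective; inj₂-injective) renaming (≡-dec to ⊎-≡-dec)
open import Data.Unit.Base using (⊤; tt)
open import Data.Vec.Base as Vec using (Vec; []; _∷_)
import Data.Vec.Functional as Vector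
open import Function.Base using (_∘_; id)
open import Function.Bundles using (_↔_; mk⇔; Inverse; Equivalence)
import Function.Construct.Composition as Compose
import Function.Construct.Identity as Identity
import Function.Construct.Symmetry as Symmetry
open import Relation.Binary.Bundles using (DecTotalOrder)
open import Relation.Binary.PropositionalEquality
  using (_≡_; _≢_; refl; sym; trans; cong; cong₂; subst; subst₂)
open import Relation.Nullary using (¬_; Dec; yes; no; does; contradiction)
open import Relation.Nullary.Decidable using (does-⇔; dec-true; dec-false; from-yes)

open module Ring = CommutativeRing ℝ-commutativeRing
  using (+-cong; *-cong; +-assoc; +-comm; +-identityˡ; +-identityʳ; *-identityˡ;
         zeroˡ; zeroʳ; distribˡ; distribʳ; *-assoc; *-comm)
  renaming (refl to ≃-refl; sym to ≃-sym; trans to ≃-trans; reflexive to ≃-reflexive)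
open import Algebra.Properties.CommutativeMonoid.Sum Ring.+-commutativeMonoid
  using (sum-cong-≋; sum-replicate-zero; ∑-distrib-+; ∑-comm)
open import Algebra.Properties.Semiring.Sum Ring.semiring using (*-distribˡ-sum; *-distribʳ-sum)
open import Relation.Binary.Reasoning.Setoid Ring.setoid

-- Finite sums

-- The matrix on the copies acts at each position of the path separately, so it commutes with
-- adjacency inside the copies for every `H`. Only the ends and the new vertices restrict it, and
-- there the condition is on incidence matrices whose size does not depend on `H`: one finite check
-- of rational matrices serves all cycle lengths.
--
-- `H` must be even, because both ends of a copy have to lie on the side opposite to the new
-- vertices. Hence 2H + 6 is always 2 modulo 4 and 2H + 4 is always 0 modulo 4, and a single pair
-- could not reach every even length.
--
-- Counting cycles for arbitrary `H` cannot be done by enumeration. Instead, ranks on the vertices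
-- certify that the hanging trees carry no cycle; where at most two neighbours of rank 0 remain at
-- each vertex of rank 0, a cycle through all of these vertices is the only one.
--
-- A pair is added only at a tie, where it turns equal numbers x, x into x + 1, x. Added to unequal
-- numbers it could make them equal.

indicator : Bool → ℝ
indicator b = if b then 1ℝ else 0ℝ

Σᴸ : List ℝ → ℝ
Σᴸ = foldr _+ℝ_ 0ℝ

Σᴸ-++ : ∀ xs ys → Σᴸ (xs ++ ys) ≃ Σᴸ xs +ℝ Σᴸ ys
Σᴸ-++ []       ys = ≃-sym (+-identityˡ _)
Σᴸ-++ (x ∷ xs) ys = ≃-trans (+-cong ≃-refl (Σᴸ-++ xs ys)) (≃-sym (+-assoc _ _ _))

module _ {A : Set} where

  Σᴸ-cong : ∀ {f g : A → ℝ} (xs : List A) → (∀ x → f x ≃ g x) → Σᴸ (map f xs) ≃ Σᴸ (map g xs)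
  Σᴸ-cong []       f≃g = ≃-refl
  Σᴸ-cong (x ∷ xs) f≃g = +-cong (f≃g x) (Σᴸ-cong xs f≃g)

  Σᴸ-distrib-+ : ∀ (f g : A → ℝ) xs →
    Σᴸ (map (λ x → f x +ℝ g x) xs) ≃ Σᴸ (map f xs) +ℝ Σᴸ (map g xs)
  Σᴸ-distrib-+ f g []       = ≃-sym (+-identityˡ _)
  Σᴸ-distrib-+ f g (x ∷ xs) = begin
    (f x +ℝ g x) +ℝ Σᴸ (map (λ x → f x +ℝ g x) xs) ≈⟨ +-cong ≃-refl (Σᴸ-distrib-+ f g xs) ⟩
    (f x +ℝ g x) +ℝ (F +ℝ G)                       ≈⟨ +-assoc _ _ _ ⟩
    f x +ℝ (g x +ℝ (F +ℝ G))                       ≈⟨ +-cong ≃-refl (≃-sym (+-assoc _ _ _)) ⟩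
    f x +ℝ ((g x +ℝ F) +ℝ G)                       ≈⟨ +-cong ≃-refl (+-cong (+-comm _ _) ≃-refl) ⟩
    f x +ℝ ((F +ℝ g x) +ℝ G)                       ≈⟨ +-cong ≃-refl (+-assoc _ _ _) ⟩
    f x +ℝ (F +ℝ (g x +ℝ G))                       ≈⟨ ≃-sym (+-assoc _ _ _) ⟩
    (f x +ℝ F) +ℝ (g x +ℝ G)                       ∎
    where
    F = Σᴸ (map f xs)
    G = Σᴸ (map g xs)

  Σᴸ-distrib-* : ∀ c (f : A → ℝ) xs → Σᴸ (map (λ x → c *ℝ f x) xs) ≃ c *ℝ Σᴸ (map f xs)
  Σᴸ-distrib-* c f []       = ≃-sym (zeroʳ c)
  Σᴸ-distrib-* c f (x ∷ xs) = ≃-trans (+-cong ≃-refl (Σᴸ-distrib-* c f xs)) (≃-sym (distribˡ _ _ _))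

sum-0* : ∀ {n} (w : Fin n → ℝ) → sumℝ (λ j → 0ℝ *ℝ w j) ≃ 0ℝ
sum-0* {n} w = ≃-trans (sum-cong-≋ λ j → zeroˡ (w j)) (sum-replicate-zero n)

sum-δ : ∀ {n} (i : Fin n) (w : Fin n → ℝ) →
  sumℝ (λ j → indicator (does (j Finₚ.≟ i)) *ℝ w j) ≃ w i
sum-δ zero    w = ≃-trans (+-cong (*-identityˡ _) (sum-0* (w ∘ suc))) (+-identityʳ _)
sum-δ (suc i) w = ≃-trans (+-cong (zeroˡ _) (sum-δ i (w ∘ suc))) (+-identityˡ _)

indicator-∨ : ∀ a b → ¬ (T a × T b) → indicator (a ∨ b) ≃ indicator a +ℝ indicator b
indicator-∨ true  true  ¬ab = ⊥-elim (¬ab (_ , _))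
indicator-∨ true  false ¬ab = ≃-sym (+-identityʳ _)
indicator-∨ false b     ¬ab = ≃-sym (+-identityˡ _)

infix 4 _∈?_
_∈?_ : ∀ {n} (i : Fin n) (is : List (Fin n)) → Dec (i ∈ is)
_∈?_ = DecMembership._∈?_ Finₚ._≟_

T-does⁻ : ∀ {P : Set} {P? : Dec P} → T (does P?) → P
T-does⁻ {P? = yes p} _ = p

T-does⁺ : ∀ {P : Set} {P? : Dec P} → P → T (does P?)
T-does⁺ {P? = yes p} _ = _
T-does⁺ {P? = no ¬p} p = ¬p p

-- Induction on the list: membership in `i ∷ is` evaluates to a disjunction, and the absence of
-- repetitions makes its two cases exclusive, so that the indicator is additive.
sum-∈ : ∀ {n} {is : List (Fin n)} → Unique is → ∀ (w : Fin n → ℝ) →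
  sumℝ (λ j → indicator (does (j ∈? is)) *ℝ w j) ≃ Σᴸ (map w is)
sum-∈ []           w = sum-0* w
sum-∈ {is = i ∷ is} (i∉is ∷ uniq) w = begin
  sumℝ (λ j → indicator (does (j ∈? i ∷ is)) *ℝ w j)
    ≈⟨ sum-cong-≋ (λ j → *-cong (indicator-∨ (does (j Finₚ.≟ i)) (does (j ∈? is)) (disjoint j)) ≃-refl) ⟩
  sumℝ (λ j → (indicator (does (j Finₚ.≟ i)) +ℝ indicator (does (j ∈? is))) *ℝ w j)
    ≈⟨ sum-cong-≋ (λ j → distribʳ (w j) _ _) ⟩
  sumℝ (λ j → indicator (does (j Finₚ.≟ i)) *ℝ w j +ℝ indicator (does (j ∈? is)) *ℝ w j)
    ≈⟨ ∑-distrib-+ (λ j → indicator (does (j Finₚ.≟ i)) *ℝ w j) _ ⟩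
  sumℝ (λ j → indicator (does (j Finₚ.≟ i)) *ℝ w j) +ℝ sumℝ (λ j → indicator (does (j ∈? is)) *ℝ w j)
    ≈⟨ +-cong (sum-δ i w) (sum-∈ uniq w) ⟩
  w i +ℝ Σᴸ (map w is) ∎
  where
  disjoint : ∀ j → ¬ (T (does (j Finₚ.≟ i)) × T (does (j ∈? is)))
  disjoint j (p , q) with refl ← T-does⁻ {P? = j Finₚ.≟ i} p =
    All.lookup i∉is (T-does⁻ {P? = j ∈? is} q) refl

-- Half-regular bipartite graphs with degree 2 on one side

record Bigraph : Set₁ where
  field
    V           : Set
    size        : ℕ
    enum        : V ↔ Fin size
    nbrs        : V → List V
    nbrs-unique : ∀ v → Unique (nbrs v)
    nbrs-sym    : ∀ {u v} → u ∈ nbrs v → v ∈ nbrs u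
    colour      : V → Bool
    colour-≢    : ∀ {u v} → u ∈ nbrs v → colour u ≢ colour v
    binary      : ∀ v → colour v ≡ true → length (nbrs v) ≡ 2

  index : V → Fin size
  index = Inverse.to enum

  vertexAt : Fin size → V
  vertexAt = Inverse.from enum

  vertexAt-index : ∀ v → vertexAt (index v) ≡ v
  vertexAt-index v = Inverse.strictlyInverseʳ enum v

  index-vertexAt : ∀ i → index (vertexAt i) ≡ i
  index-vertexAt i = Inverse.strictlyInverseˡ enum i

  index-injective : ∀ {u v} → index u ≡ index v → u ≡ v
  index-injective {u} {v} eq =
    trans (sym (vertexAt-index u)) (trans (cong vertexAt eq) (vertexAt-index v))

  nbrIndices : Fin size → List (Fin size)
  nbrIndices i = map index (nbrs (vertexAt i))

  nbrIndices-unique : ∀ i → Unique (nbrIndices i)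
  nbrIndices-unique i = Unique.map⁺ index-injective (nbrs-unique (vertexAt i))

  ∈-nbrIndices⁻ : ∀ {i j} → j ∈ nbrIndices i → vertexAt j ∈ nbrs (vertexAt i)
  ∈-nbrIndices⁻ {i} p with v , v∈ , refl ← ∈-map⁻ index p =
    subst (_∈ nbrs (vertexAt i)) (sym (vertexAt-index v)) v∈

  ∈-nbrIndices⁺ : ∀ {i j} → vertexAt j ∈ nbrs (vertexAt i) → j ∈ nbrIndices i
  ∈-nbrIndices⁺ {i} {j} p = subst (_∈ nbrIndices i) (index-vertexAt j) (∈-map⁺ index p)

  nbrIndices-sym : ∀ {i j} → j ∈ nbrIndices i → i ∈ nbrIndices j
  nbrIndices-sym = ∈-nbrIndices⁺ ∘ nbrs-sym ∘ ∈-nbrIndices⁻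

  graph : Graph
  graph = record
    { order       = size
    ; adj         = λ i j → does (j ∈? nbrIndices i)
    ; symmetric   = λ i j → does-⇔ (mk⇔ nbrIndices-sym nbrIndices-sym) (j ∈? nbrIndices i) (i ∈? nbrIndices j)
    ; irreflexive = λ i → dec-false (i ∈? nbrIndices i) λ p → colour-≢ (∈-nbrIndices⁻ p) refl
    }

  adjacent⁻ : ∀ {i j} → Adjacent graph i j → vertexAt j ∈ nbrs (vertexAt i)
  adjacent⁻ {i} {j} p = ∈-nbrIndices⁻ (T-does⁻ {P? = j ∈? nbrIndices i} p)

  adjacent⁺ : ∀ {i j} → vertexAt j ∈ nbrs (vertexAt i) → Adjacent graph i j
  adjacent⁺ {i} {j} p = T-does⁺ {P? = j ∈? nbrIndices i} (∈-nbrIndices⁺ p)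

  -- The adjacency matrix as an operator on functions on `V`. Similarities can thus be built along
  -- sums and products of vertex types, without arithmetic on indices in `Fin size`.
  operator : (V → ℝ) → V → ℝ
  operator f v = Σᴸ (map f (nbrs v))

  adjacencyMatrix-operator : ∀ (w : Fin size → ℝ) i →
    (adjacencyMatrix graph ·ᵥ w) i ≃ operator (w ∘ index) (vertexAt i)
  adjacencyMatrix-operator w i = ≃-trans (sum-∈ (nbrIndices-unique i) w)
    (≃-reflexive (cong Σᴸ (sym (map-∘ (nbrs (vertexAt i))))))

  operator-cong : ∀ {f g} → (∀ v → f v ≃ g v) → ∀ v → operator f v ≃ operator g v
  operator-cong f≃g v = Σᴸ-cong (nbrs v) f≃g

open Bigraph public

-- Similar adjacency operators

record IsLinear {A B : Set} (φ : (A → ℝ) → (B → ℝ)) : Set where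
  field
    φ-cong  : ∀ {f g} → (∀ a → f a ≃ g a) → ∀ b → φ f b ≃ φ g b
    φ-+     : ∀ f g b → φ (λ a → f a +ℝ g a) b ≃ φ f b +ℝ φ g b
    φ-*     : ∀ c f b → φ (λ a → c *ℝ f a) b ≃ c *ℝ φ f b

  φ-0 : ∀ b → φ (λ _ → 0ℝ) b ≃ 0ℝ
  φ-0 b = ≃-trans (φ-cong (λ a → ≃-sym (zeroˡ 0ℝ)) b) (≃-trans (φ-* 0ℝ (λ _ → 0ℝ) b) (zeroˡ _))

  φ-sum : ∀ {m} (F : Fin m → A → ℝ) b → φ (λ a → sumℝ λ k → F k a) b ≃ sumℝ λ k → φ (F k) b
  φ-sum {zero}  F b = φ-0 b
  φ-sum {suc m} F b = ≃-trans (φ-+ (F zero) _ b) (+-cong ≃-refl (φ-sum (F ∘ suc) b))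

  φ-Σᴸ : ∀ {C : Set} (F : C → A → ℝ) xs b →
    φ (λ a → Σᴸ (map (λ x → F x a) xs)) b ≃ Σᴸ (map (λ x → φ (F x) b) xs)
  φ-Σᴸ F []       b = φ-0 b
  φ-Σᴸ F (x ∷ xs) b = ≃-trans (φ-+ (F x) _ b) (+-cong ≃-refl (φ-Σᴸ F xs b))

open IsLinear

infix 4 _~_

-- Conjugacy of the two adjacency operators by the invertible linear map `to`. One intertwining law
-- is enough: conjugating it with `from` gives the law for the inverse.
record _~_ (X Y : Bigraph) : Set where
  field
    to          : (V X → ℝ) → (V Y → ℝ)
    from        : (V Y → ℝ) → (V X → ℝ)
    to-linear   : IsLinear to
    from-linear : IsLinear from
    to-from     : ∀ g w → to (from g) w ≃ g w
    from-to     : ∀ f v → from (to f) v ≃ f v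
    intertwines : ∀ f w → to (operator X f) w ≃ operator Y (to f) w

~-sym : ∀ {X Y} → X ~ Y → Y ~ X
~-sym {X} {Y} s = record
  { to = from ; from = to ; to-linear = from-linear ; from-linear = to-linear
  ; to-from = from-to ; from-to = to-from
  ; intertwines = λ g v → begin
      from (operator Y g) v            ≈⟨ φ-cong from-linear (operator-cong Y λ w → ≃-sym (to-from g w)) v ⟩
      from (operator Y (to (from g))) v ≈⟨ φ-cong from-linear (λ w → ≃-sym (intertwines (from g) w)) v ⟩
      from (to (operator X (from g))) v ≈⟨ from-to (operator X (from g)) v ⟩
      operator X (from g) v            ∎
  }
  where open _~_ s

eigenvector-transfer : ∀ X Y (s : X ~ Y) lam (v : Fin (size X) → ℝ) →
  InEigenspace (adjacencyMatrix (graph X)) lam v →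
  InEigenspace (adjacencyMatrix (graph Y)) lam (λ i → _~_.to s (v ∘ index X) (vertexAt Y i))
eigenvector-transfer X Y s lam v eig i = begin
  (adjacencyMatrix (graph Y) ·ᵥ (λ i → to (v ∘ index X) (vertexAt Y i))) i
    ≈⟨ adjacencyMatrix-operator Y _ i ⟩
  operator Y (λ w → to (v ∘ index X) (vertexAt Y (index Y w))) (vertexAt Y i)
    ≈⟨ operator-cong Y (λ w → ≃-reflexive (cong (to (v ∘ index X)) (vertexAt-index Y w))) (vertexAt Y i) ⟩
  operator Y (to (v ∘ index X)) (vertexAt Y i)
    ≈⟨ ≃-sym (intertwines (v ∘ index X) (vertexAt Y i)) ⟩
  to (operator X (v ∘ index X)) (vertexAt Y i)
    ≈⟨ φ-cong to-linear (λ u → ≃-sym (≃-trans (adjacencyMatrix-operator X v (index X u))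
         (≃-reflexive (cong (operator X (v ∘ index X)) (vertexAt-index X u))))) (vertexAt Y i) ⟩
  to (λ u → (adjacencyMatrix (graph X) ·ᵥ v) (index X u)) (vertexAt Y i)
    ≈⟨ φ-cong to-linear (λ u → eig (index X u)) (vertexAt Y i) ⟩
  to (λ u → lam *ℝ v (index X u)) (vertexAt Y i)
    ≈⟨ φ-* to-linear lam (v ∘ index X) (vertexAt Y i) ⟩
  lam *ℝ to (v ∘ index X) (vertexAt Y i) ∎
  where open _~_ s

-- A similarity restricts to an isomorphism between the eigenspaces for the same `lam`, and an
-- isomorphism carries a basis to a basis. For spanning, an eigenvector is pulled back, expanded
-- there and pushed forward again. No diagonalisation is involved.
multiplicity-transfer : ∀ {X Y} → X ~ Y → ∀ lam m →
  HasMultiplicity (adjacencyMatrix (graph X)) lam m → HasMultiplicity (adjacencyMatrix (graph Y)) lam m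
multiplicity-transfer {X} {Y} s lam m (b , eigen , independent , spanning) =
  (λ k → push (b k)) , (λ k → eigenvector-transfer X Y s lam (b k) (eigen k)) , independent′ , spanning′
  where
  open _~_ s

  push : (Fin (size X) → ℝ) → Fin (size Y) → ℝ
  push v i = to (v ∘ index X) (vertexAt Y i)

  pull : (Fin (size Y) → ℝ) → Fin (size X) → ℝ
  pull w i = from (w ∘ index Y) (vertexAt X i)

  pull-push : ∀ v → pull (push v) ≋ v
  pull-push v i = begin
    from (λ w → to (v ∘ index X) (vertexAt Y (index Y w))) (vertexAt X i)
      ≈⟨ φ-cong from-linear (λ w → ≃-reflexive (cong (to (v ∘ index X)) (vertexAt-index Y w))) (vertexAt X i) ⟩
    from (to (v ∘ index X)) (vertexAt X i) ≈⟨ from-to (v ∘ index X) (vertexAt X i) ⟩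
    v (index X (vertexAt X i))             ≈⟨ ≃-reflexive (cong v (index-vertexAt X i)) ⟩
    v i                                    ∎

  push-pull : ∀ w → push (pull w) ≋ w
  push-pull w i = begin
    to (λ v → from (w ∘ index Y) (vertexAt X (index X v))) (vertexAt Y i)
      ≈⟨ φ-cong to-linear (λ v → ≃-reflexive (cong (from (w ∘ index Y)) (vertexAt-index X v))) (vertexAt Y i) ⟩
    to (from (w ∘ index Y)) (vertexAt Y i) ≈⟨ to-from (w ∘ index Y) (vertexAt Y i) ⟩
    w (index Y (vertexAt Y i))             ≈⟨ ≃-reflexive (cong w (index-vertexAt Y i)) ⟩
    w i                                    ∎

  push-combination : ∀ c → combination c (λ k → push (b k)) ≋ push (combination c b)
  push-combination c i = ≃-sym (≃-trans
    (φ-sum to-linear (λ k u → c k *ℝ b k (index X u)) (vertexAt Y i))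
    (sum-cong-≋ λ k → φ-* to-linear (c k) (b k ∘ index X) (vertexAt Y i)))

  independent′ : LinearlyIndependent (λ k → push (b k))
  independent′ c c≋0 = independent c λ i → begin
    combination c b i                ≈⟨ ≃-sym (pull-push (combination c b) i) ⟩
    pull (push (combination c b)) i  ≈⟨ φ-cong from-linear (λ w →
        ≃-trans (≃-sym (push-combination c (index Y w))) (c≋0 (index Y w))) (vertexAt X i) ⟩
    from (λ _ → 0ℝ) (vertexAt X i)   ≈⟨ φ-0 from-linear (vertexAt X i) ⟩
    0ℝ                               ∎

  spanning′ : ∀ w → InEigenspace (adjacencyMatrix (graph Y)) lam w →
    ∃ λ c → w ≋ combination c (λ k → push (b k))
  spanning′ w eig = let c , pull-w≋ = spanning (pull w) (eigenvector-transfer Y X (~-sym s) lam w eig) in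
    c , λ i → begin
    w i                              ≈⟨ ≃-sym (push-pull w i) ⟩
    push (pull w) i                  ≈⟨ φ-cong to-linear (λ v → pull-w≋ (index X v)) (vertexAt Y i) ⟩
    push (combination c b) i         ≈⟨ ≃-sym (push-combination c i) ⟩
    combination c (λ k → push (b k)) i ∎

sameSpectrum : ∀ {X Y} → X ~ Y → SameSpectrum (graph X) (graph Y)
sameSpectrum s lam m = mk⇔ (multiplicity-transfer s lam m) (multiplicity-transfer (~-sym s) lam m)

-- Degrees

unique-↭ : ∀ {A : Set} {xs ys : List A} → Unique xs → Unique ys →
  (∀ {z} → z ∈ xs → z ∈ ys) → (∀ {z} → z ∈ ys → z ∈ xs) → xs ↭ ys
unique-↭ xs! ys! ⊆ ⊇ = ∼bag⇒↭ (unique∧set⇒bag xs! ys! (mk⇔ ⊆ ⊇))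

-- The filtered list of all indices and the neighbour list have the same elements and no
-- repetitions, so one is a permutation of the other.
degree-nbrs : ∀ X i → degree (graph X) i ≡ length (nbrs X (vertexAt X i))
degree-nbrs X i = trans (↭-length (unique-↭
    (Unique.filter⁺ (T? ∘ adj (graph X) i) (Unique.allFin⁺ _)) (nbrIndices-unique X i)
    (λ p → ∈-nbrIndices⁺ X (adjacent⁻ X (proj₂ (∈-filter⁻ (T? ∘ adj (graph X) i) {xs = allFin _} p))))
    (λ p → ∈-filter⁺ (T? ∘ adj (graph X) i) (∈-allFin _) (adjacent⁺ X (∈-nbrIndices⁻ X p)))))
  (length-map (index X) (nbrs X (vertexAt X i)))

sort-≡ : ∀ {xs ys : List ℕ} → xs ↭ ys → sort xs ≡ sort ys
sort-≡ {xs} {ys} xs↭ys = Pointwise-≡⇒≡ (↗↭↗⇒≋ (DecTotalOrder.totalOrder ≥-decTotalOrder)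
  (sort-↗ xs) (sort-↗ ys)
  (↭⇒↭ₛ (↭-trans (sort-↭ xs) (↭-trans xs↭ys (↭-sym (sort-↭ ys))))))

-- Degree sequences only see the multiset of degrees on each side. Such a bijection may therefore
-- break adjacency, unlike an isomorphism.
record DegreeMatching (X Y : Bigraph) : Set where
  field
    match        : V X ↔ V Y
    match-colour : ∀ v → colour Y (Inverse.to match v) ≡ colour X v
    match-degree : ∀ v → length (nbrs Y (Inverse.to match v)) ≡ length (nbrs X v)

bipartition : ∀ X → Bipartition (graph X)
bipartition X = record
  { side   = λ i → colour X (vertexAt X i)
  ; proper = λ i j i~j eq → colour-≢ X (adjacent⁻ X i~j) (sym eq)
  }

sameDegreeSequences : ∀ {X Y} → DegreeMatching X Y → SameDegreeSequences (graph X) (graph Y)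
sameDegreeSequences {X} {Y} M = bipartition X , bipartition Y , λ s →
  sort-≡ (subst₂ _↭_ (degrees s) refl (↭-map⁺ (degree (graph Y)) (σ-sides s)))
  where
  open DegreeMatching M

  sideList : ∀ Z → Bool → List (Fin (size Z))
  sideList Z s = filter (λ i → colour Z (vertexAt Z i) ≟ᵇ s) (allFin (size Z))

  σ : Fin (size X) → Fin (size Y)
  σ i = index Y (Inverse.to match (vertexAt X i))

  τ : Fin (size Y) → Fin (size X)
  τ j = index X (Inverse.from match (vertexAt Y j))

  τσ : ∀ i → τ (σ i) ≡ i
  τσ i = trans (cong (index X ∘ Inverse.from match) (vertexAt-index Y _))
    (trans (cong (index X) (Inverse.strictlyInverseʳ match _)) (index-vertexAt X i))

  στ : ∀ j → σ (τ j) ≡ j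
  στ j = trans (cong (index Y ∘ Inverse.to match) (vertexAt-index X _))
    (trans (cong (index Y) (Inverse.strictlyInverseˡ match _)) (index-vertexAt Y j))

  σ-colour : ∀ i → colour Y (vertexAt Y (σ i)) ≡ colour X (vertexAt X i)
  σ-colour i = trans (cong (colour Y) (vertexAt-index Y _)) (match-colour _)

  σ-degree : ∀ i → degree (graph Y) (σ i) ≡ degree (graph X) i
  σ-degree i = trans (degree-nbrs Y (σ i)) (trans (cong (length ∘ nbrs Y) (vertexAt-index Y _))
    (trans (match-degree _) (sym (degree-nbrs X i))))

  degrees : ∀ s → map (degree (graph Y)) (map σ (sideList X s)) ≡ map (degree (graph X)) (sideList X s)
  degrees s = trans (sym (map-∘ (sideList X s))) (map-cong σ-degree (sideList X s))

  σ-sides : ∀ s → map σ (sideList X s) ↭ sideList Y s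
  σ-sides s = unique-↭
    (Unique.map⁺ (λ {i} {j} eq → trans (sym (τσ i)) (trans (cong τ eq) (τσ j)))
      (Unique.filter⁺ (λ i → colour X (vertexAt X i) ≟ᵇ s) (Unique.allFin⁺ _)))
    (Unique.filter⁺ (λ i → colour Y (vertexAt Y i) ≟ᵇ s) (Unique.allFin⁺ _))
    (λ p → let i , i∈ , eq = ∈-map⁻ σ p in
      subst (_∈ sideList Y s) (sym eq) (∈-filter⁺ (λ j → colour Y (vertexAt Y j) ≟ᵇ s) (∈-allFin _)
        (trans (σ-colour i) (proj₂ (∈-filter⁻ (λ i → colour X (vertexAt X i) ≟ᵇ s) {xs = allFin _} i∈)))))
    (λ {j} p → subst (_∈ map σ (sideList X s)) (στ j) (∈-map⁺ σ
      (∈-filter⁺ (λ i → colour X (vertexAt X i) ≟ᵇ s) (∈-allFin _)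
        (trans (sym (σ-colour (τ j))) (trans (cong (colour Y ∘ vertexAt Y) (στ j))
          (proj₂ (∈-filter⁻ (λ j → colour Y (vertexAt Y j) ≟ᵇ s) {xs = allFin _} p)))))))

-- Two vertices at distance two lie on the same side of every bipartition.
Uneven : Bigraph → Set
Uneven X = ∃ λ w → ∃₂ λ u v → u ∈ nbrs X w × v ∈ nbrs X w × length (nbrs X u) ≢ length (nbrs X v)

halfRegular : ∀ X → Uneven X → HalfRegular (graph X)
halfRegular X (w , u , v , u∈ , v∈ , deg≢) =
    (bipartition X , true , 2 , λ i eq → trans (degree-nbrs X i) (binary X (vertexAt X i) eq))
  , λ (P , regular) →
      let d , deg≡d = regular (not (side P (index X w)))
          near : ∀ {x} → x ∈ nbrs X w → degree (graph X) (index X x) ≡ d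
          near x∈ = deg≡d _ (¬-not (proper P _ _ (adjacent⁺ X
            (subst₂ (λ a b → a ∈ nbrs X b) (sym (vertexAt-index X w)) (sym (vertexAt-index X _)) (nbrs-sym X x∈)))))
          deg : ∀ x → degree (graph X) (index X x) ≡ length (nbrs X x)
          deg x = trans (degree-nbrs X (index X x)) (cong (length ∘ nbrs X) (vertexAt-index X x))
      in deg≢ (trans (sym (deg u)) (trans (near u∈) (trans (sym (near v∈)) (deg v))))

-- Cycles

record Circuit (X : Bigraph) (ℓ : ℕ) : Set where
  field
    3≤ℓ       : 3 ≤ ℓ
    at        : Fin ℓ → V X
    injective : ∀ {i j} → at i ≡ at j → i ≡ j
    linked    : ∀ {i j} → Next i j → at j ∈ nbrs X (at i)

open Circuit public

EdgeIn : ∀ {X ℓ} → Circuit X ℓ → V X → V X → Set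
EdgeIn C u v = ∃₂ λ i j → Next i j × ((u ≡ at C i × v ≡ at C j) ⊎ (u ≡ at C j × v ≡ at C i))

infix 4 _⊑_ _≈ᶜ_

-- The two lengths are independent, because `circuit-unique` has to compare circuits before their
-- lengths are known to agree.
_⊑_ : ∀ {X m n} → Circuit X m → Circuit X n → Set
C ⊑ D = ∀ {u v} → EdgeIn C u v → EdgeIn D u v

_≈ᶜ_ : ∀ {X m n} → Circuit X m → Circuit X n → Set
C ≈ᶜ D = C ⊑ D × D ⊑ C

circuit : ∀ {X ℓ} → Cycle (graph X) ℓ → Circuit X ℓ
circuit {X} C = record
  { 3≤ℓ       = 3≤length C
  ; at        = λ i → vertexAt X (vertex C i)
  ; injective = λ {i} {j} eq → distinct C (trans (sym (index-vertexAt X _))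
      (trans (cong (index X) eq) (index-vertexAt X _)))
  ; linked    = λ {i} {j} next → adjacent⁻ X (adjacent C i j next)
  }

cycle : ∀ {X ℓ} → Circuit X ℓ → Cycle (graph X) ℓ
cycle {X} C = record
  { 3≤length = 3≤ℓ C
  ; vertex   = λ i → index X (at C i)
  ; distinct = λ eq → injective C (index-injective X eq)
  ; adjacent = λ i j next → adjacent⁺ X
      (subst₂ (λ u v → u ∈ nbrs X v) (sym (vertexAt-index X _)) (sym (vertexAt-index X _)) (linked C next))
  }

module _ {X : Bigraph} {ℓ : ℕ} where

  private
    move : ∀ {u x} → vertexAt X u ≡ x → u ≡ index X x
    move eq = trans (sym (index-vertexAt X _)) (cong (index X) eq)

    move′ : ∀ {u x} → u ≡ index X x → vertexAt X u ≡ x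
    move′ eq = trans (cong (vertexAt X) eq) (vertexAt-index X _)

    unmove : ∀ {u x} → vertexAt X u ≡ vertexAt X x → u ≡ x
    unmove eq = trans (move eq) (index-vertexAt X _)

  edgeOf-cycle⁺ : ∀ (C : Circuit X ℓ) {u v} → EdgeIn C (vertexAt X u) (vertexAt X v) → EdgeOf (cycle C) u v
  edgeOf-cycle⁺ C (i , j , next , inj₁ (p , q)) = i , j , next , inj₁ (move p , move q)
  edgeOf-cycle⁺ C (i , j , next , inj₂ (p , q)) = i , j , next , inj₂ (move p , move q)

  edgeOf-cycle⁻ : ∀ (C : Circuit X ℓ) {u v} → EdgeOf (cycle C) u v → EdgeIn C (vertexAt X u) (vertexAt X v)
  edgeOf-cycle⁻ C (i , j , next , inj₁ (p , q)) = i , j , next , inj₁ (move′ p , move′ q)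
  edgeOf-cycle⁻ C (i , j , next , inj₂ (p , q)) = i , j , next , inj₂ (move′ p , move′ q)

  edgeIn-circuit⁺ : ∀ (D : Cycle (graph X) ℓ) {u v} → EdgeOf D u v →
    EdgeIn (circuit {X} D) (vertexAt X u) (vertexAt X v)
  edgeIn-circuit⁺ D (i , j , next , inj₁ (p , q)) = i , j , next , inj₁ (cong (vertexAt X) p , cong (vertexAt X) q)
  edgeIn-circuit⁺ D (i , j , next , inj₂ (p , q)) = i , j , next , inj₂ (cong (vertexAt X) p , cong (vertexAt X) q)

  edgeIn-circuit⁻ : ∀ (D : Cycle (graph X) ℓ) {u v} →
    EdgeIn (circuit {X} D) (vertexAt X u) (vertexAt X v) → EdgeOf D u v
  edgeIn-circuit⁻ D (i , j , next , inj₁ (p , q)) = i , j , next , inj₁ (unmove p , unmove q)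
  edgeIn-circuit⁻ D (i , j , next , inj₂ (p , q)) = i , j , next , inj₂ (unmove p , unmove q)

record CircuitCount (X : Bigraph) (ℓ n : ℕ) : Set where
  field
    enumerate : Fin n → Circuit X ℓ
    separate  : ∀ {i j} → enumerate i ≈ᶜ enumerate j → i ≡ j
    exhaust   : ∀ (D : Circuit X ℓ) → ∃ λ i → enumerate i ≈ᶜ D

open CircuitCount public

numberOfCycles : ∀ {X ℓ n} → CircuitCount X ℓ n → NumberOfCycles (graph X) ℓ n
numberOfCycles {X} {ℓ} {n} count = record
  { to        = λ i → cycle (enumerate count i)
  ; cong      = λ { refl u v → mk⇔ id id }
  ; bijective = (λ {i} {j} eq → separate count
                    (half (λ u v → Equivalence.to (eq u v)) , half (λ u v → Equivalence.from (eq u v))))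
              , λ D → let i , ⊑D , D⊑ = exhaust count (circuit D) in
                  i , λ { refl u v → mk⇔ (edgeIn-circuit⁻ {X} D ∘ ⊑D ∘ edgeOf-cycle⁻ (enumerate count i))
                                         (edgeOf-cycle⁺ (enumerate count i) ∘ D⊑ ∘ edgeIn-circuit⁺ {X} D) }
  }
  where
  half : ∀ {i j} → (∀ u v → EdgeOf (cycle (enumerate count i)) u v → EdgeOf (cycle (enumerate count j)) u v) →
    enumerate count i ⊑ enumerate count j
  half {i} {j} f {u} {v} e = subst₂ (EdgeIn (enumerate count j)) (vertexAt-index X u) (vertexAt-index X v)
    (edgeOf-cycle⁻ (enumerate count j) (f (index X u) (index X v) (edgeOf-cycle⁺ (enumerate count i)
      (subst₂ (EdgeIn (enumerate count i)) (sym (vertexAt-index X u)) (sym (vertexAt-index X v)) e))))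

-- The cyclic order

next : ∀ {n} (i : Fin (suc n)) → ∃ λ j → Next i j
next {n} i with suc (toℕ i) ℕₚ.<? suc n
... | yes i<n = fromℕ< i<n , inj₁ (Finₚ.toℕ-fromℕ< i<n)
... | no  i≮n = zero , inj₂ (ℕₚ.≤-antisym (Finₚ.toℕ<n i) (ℕₚ.≮⇒≥ i≮n) , refl)

previous : ∀ {n} (i : Fin (suc n)) → ∃ λ j → Next j i
previous {n} zero    = fromℕ n , inj₂ (cong suc (Finₚ.toℕ-fromℕ n) , refl)
previous     (suc i) = inject₁ i , inj₁ (cong suc (sym (Finₚ.toℕ-inject₁ i)))

-- If the two agreed, the cyclic order would return to `i` after two steps. The cases are which of
-- these steps wrap around; each is impossible or forces a length below 3.
next≢previous : ∀ {ℓ} → 3 ≤ ℓ → ∀ {i j k : Fin ℓ} → Next i j → Next k i → j ≢ k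
next≢previous {ℓ} 3≤ℓ {i} {j} i→j k→i refl = go i→j k→i
  where
  too-short : ∀ {n} → n < 3 → ¬ ℓ ≡ n
  too-short n<3 refl = ℕₚ.<⇒≱ n<3 3≤ℓ

  go : Next i j → ¬ Next j i
  go (inj₁ j≡)        (inj₁ i≡)        = ℕₚ.m≢1+n+m (toℕ j) {1} (trans j≡ (cong suc i≡))
  go (inj₁ j≡)        (inj₂ (j≡ℓ , i≡)) = too-short ℕₚ.≤-refl (trans (sym j≡ℓ) (cong suc (trans j≡ (cong suc i≡))))
  go (inj₂ (i≡ℓ , j≡)) (inj₁ i≡)        = too-short ℕₚ.≤-refl (trans (sym i≡ℓ) (cong suc (trans i≡ (cong suc j≡))))
  go (inj₂ (i≡ℓ , _)) (inj₂ (_ , i≡))  = too-short (s≤s (s≤s z≤n)) (trans (sym i≡ℓ) (cong suc i≡))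

-- The start is arbitrary: climb from `i₀` to the last index, wrap around to `zero`, and climb from
-- there to any index.
cyclic-induction : ∀ {ℓ} (P : Fin ℓ → Set) → (∀ {i j} → Next i j → P i → P j) →
  ∀ {i₀} → P i₀ → ∀ i → P i
cyclic-induction {suc n} P step {i₀} p = λ i → climb (toℕ i) (sym (ℕₚ.+-identityʳ _)) at-zero
  where
  climb : ∀ d {i j : Fin (suc n)} → toℕ j ≡ d + toℕ i → P i → P j
  climb zero    {i} {j}     eq p = subst P (sym (Finₚ.toℕ-injective eq)) p
  climb (suc d) {i} {suc j} eq p = step (inj₁ (cong suc (sym (Finₚ.toℕ-inject₁ j))))
    (climb d {i} {inject₁ j} (trans (Finₚ.toℕ-inject₁ j) (ℕₚ.suc-injective eq)) p)

  at-zero : P zero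
  at-zero = step (proj₂ (previous zero)) (climb (n ∸ toℕ i₀)
    (trans (Finₚ.toℕ-fromℕ n) (sym (ℕₚ.m∸n+n≡m (ℕₚ.≤-pred (Finₚ.toℕ<n i₀))))) p)

edge : ∀ {X ℓ} (C : Circuit X ℓ) → ∃₂ λ u v → EdgeIn C u v
edge {ℓ = zero}  C with () ← 3≤ℓ C
edge {ℓ = suc n} C = let j , p = next zero in at C zero , at C j , zero , j , p , inj₁ (refl , refl)

-- Disjoint unions

infixr 5 _⊕_

_⊕_ : Bigraph → Bigraph → Bigraph
X ⊕ Y = record
  { V           = V X ⊎ V Y
  ; size        = size X + size Y
  ; enum        = Compose.inverse (enum X ⊎-↔ enum Y) (Symmetry.inverse Finₚ.+↔⊎)
  ; nbrs        = Sum.[ (λ u → map inj₁ (nbrs X u)) , (λ v → map inj₂ (nbrs Y v)) ]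
  ; nbrs-unique = Sum.[ (λ u → Unique.map⁺ inj₁-injective (nbrs-unique X u))
                      , (λ v → Unique.map⁺ inj₂-injective (nbrs-unique Y v)) ]
  ; nbrs-sym    = λ {u} {v} → ⊕-sym u v
  ; colour      = Sum.[ colour X , colour Y ]
  ; colour-≢    = λ {u} {v} → ⊕-colour u v
  ; binary      = Sum.[ (λ u eq → trans (length-map inj₁ (nbrs X u)) (binary X u eq))
                      , (λ v eq → trans (length-map inj₂ (nbrs Y v)) (binary Y v eq)) ]
  }
  where
  ⊕-nbrs : V X ⊎ V Y → List (V X ⊎ V Y)
  ⊕-nbrs = Sum.[ (λ u → map inj₁ (nbrs X u)) , (λ v → map inj₂ (nbrs Y v)) ]

  ⊕-sym : ∀ u v → u ∈ ⊕-nbrs v → v ∈ ⊕-nbrs u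
  ⊕-sym u (inj₁ v) p with x , x∈ , refl ← ∈-map⁻ inj₁ p = ∈-map⁺ inj₁ (nbrs-sym X x∈)
  ⊕-sym u (inj₂ v) p with x , x∈ , refl ← ∈-map⁻ inj₂ p = ∈-map⁺ inj₂ (nbrs-sym Y x∈)

  ⊕-colour : ∀ u v → u ∈ ⊕-nbrs v → Sum.[ colour X , colour Y ] u ≢ Sum.[ colour X , colour Y ] v
  ⊕-colour u (inj₁ v) p with x , x∈ , refl ← ∈-map⁻ inj₁ p = colour-≢ X x∈
  ⊕-colour u (inj₂ v) p with x , x∈ , refl ← ∈-map⁻ inj₂ p = colour-≢ Y x∈

⊕-operator₁ : ∀ X Y f v → operator (X ⊕ Y) f (inj₁ v) ≡ operator X (f ∘ inj₁) v
⊕-operator₁ X Y f v = cong Σᴸ (sym (map-∘ (nbrs X v)))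

⊕-operator₂ : ∀ X Y f v → operator (X ⊕ Y) f (inj₂ v) ≡ operator Y (f ∘ inj₂) v
⊕-operator₂ X Y f v = cong Σᴸ (sym (map-∘ (nbrs Y v)))

⊕-degree₁ : ∀ X Y v → length (nbrs (X ⊕ Y) (inj₁ v)) ≡ length (nbrs X v)
⊕-degree₁ X Y v = length-map inj₁ (nbrs X v)

⊕-degree₂ : ∀ X Y v → length (nbrs (X ⊕ Y) (inj₂ v)) ≡ length (nbrs Y v)
⊕-degree₂ X Y v = length-map inj₂ (nbrs Y v)

⊎-linear : ∀ {A B C D : Set} {φ : (A → ℝ) → (B → ℝ)} {ψ : (C → ℝ) → (D → ℝ)} →
  IsLinear φ → IsLinear ψ → IsLinear {A ⊎ C} {B ⊎ D} (λ f → Sum.[ φ (f ∘ inj₁) , ψ (f ∘ inj₂) ])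
⊎-linear lin lin′ = record
  { φ-cong = λ f≃g → Sum.[ φ-cong lin (f≃g ∘ inj₁) , φ-cong lin′ (f≃g ∘ inj₂) ]
  ; φ-+    = λ f g → Sum.[ φ-+ lin (f ∘ inj₁) (g ∘ inj₁) , φ-+ lin′ (f ∘ inj₂) (g ∘ inj₂) ]
  ; φ-*    = λ c f → Sum.[ φ-* lin c (f ∘ inj₁) , φ-* lin′ c (f ∘ inj₂) ]
  }
  where open IsLinear

⊕-~ : ∀ {X X′ Y Y′} → X ~ X′ → Y ~ Y′ → X ⊕ Y ~ X′ ⊕ Y′
⊕-~ {X} {X′} {Y} {Y′} s t = record
  { to          = λ f → Sum.[ S.to (f ∘ inj₁) , T.to (f ∘ inj₂) ]
  ; from        = λ f → Sum.[ S.from (f ∘ inj₁) , T.from (f ∘ inj₂) ]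
  ; to-linear   = ⊎-linear S.to-linear T.to-linear
  ; from-linear = ⊎-linear S.from-linear T.from-linear
  ; to-from     = λ g → Sum.[ S.to-from (g ∘ inj₁) , T.to-from (g ∘ inj₂) ]
  ; from-to     = λ f → Sum.[ S.from-to (f ∘ inj₁) , T.from-to (f ∘ inj₂) ]
  ; intertwines = λ f → Sum.[
      (λ w → ≃-trans (IsLinear.φ-cong S.to-linear (λ v → ≃-reflexive (⊕-operator₁ X Y f v)) w)
        (≃-trans (S.intertwines (f ∘ inj₁) w) (≃-reflexive (sym (⊕-operator₁ X′ Y′ _ w))))) ,
      (λ w → ≃-trans (IsLinear.φ-cong T.to-linear (λ v → ≃-reflexive (⊕-operator₂ X Y f v)) w)
        (≃-trans (T.intertwines (f ∘ inj₂) w) (≃-reflexive (sym (⊕-operator₂ X′ Y′ _ w))))) ]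
  }
  where
  module S = _~_ s
  module T = _~_ t

~-refl : ∀ {X} → X ~ X
~-refl = record
  { to = id ; from = id ; to-linear = id-linear ; from-linear = id-linear
  ; to-from = λ _ _ → ≃-refl ; from-to = λ _ _ → ≃-refl ; intertwines = λ _ _ → ≃-refl }
  where
  id-linear : ∀ {A : Set} → IsLinear {A} id
  id-linear = record { φ-cong = id ; φ-+ = λ _ _ _ → ≃-refl ; φ-* = λ _ _ _ → ≃-refl }

⊕-match : ∀ {X X′ Y Y′} → DegreeMatching X X′ → DegreeMatching Y Y′ → DegreeMatching (X ⊕ Y) (X′ ⊕ Y′)
⊕-match {X} {X′} {Y} {Y′} M N = record
  { match        = match M ⊎-↔ match N
  ; match-colour = Sum.[ match-colour M , match-colour N ]
  ; match-degree = Sum.[ (λ v → trans (⊕-degree₁ X′ Y′ _) (trans (match-degree M v) (sym (⊕-degree₁ X Y v))))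
                       , (λ v → trans (⊕-degree₂ X′ Y′ _) (trans (match-degree N v) (sym (⊕-degree₂ X Y v)))) ]
  }
  where open DegreeMatching

match-refl : ∀ {X} → DegreeMatching X X
match-refl = record
  { match = Identity.↔-id _
  ; match-colour = λ _ → refl ; match-degree = λ _ → refl }

⊕-uneven : ∀ {X Y} → Uneven X → Uneven (X ⊕ Y)
⊕-uneven {X} {Y} (w , u , v , u∈ , v∈ , deg≢) = inj₁ w , inj₁ u , inj₁ v , ∈-map⁺ inj₁ u∈ , ∈-map⁺ inj₁ v∈ ,
  λ eq → deg≢ (trans (sym (⊕-degree₁ X Y u)) (trans eq (⊕-degree₁ X Y v)))

-- An embedding as an induced subgraph. Reflecting adjacency is what lets a circuit of `Z` inside
-- the image be pulled back to `X`.
record Embedding (X Z : Bigraph) : Set where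
  field
    ι           : V X → V Z
    ι-injective : ∀ {u v} → ι u ≡ ι v → u ≡ v
    ι-nbrs⁺     : ∀ {u v} → u ∈ nbrs X v → ι u ∈ nbrs Z (ι v)
    ι-nbrs⁻     : ∀ {u v} → ι u ∈ nbrs Z (ι v) → u ∈ nbrs X v

  image : ∀ {ℓ} → Circuit X ℓ → Circuit Z ℓ
  image C = record
    { 3≤ℓ = 3≤ℓ C ; at = ι ∘ at C ; injective = λ eq → injective C (ι-injective eq)
    ; linked = λ p → ι-nbrs⁺ (linked C p) }

  edge-image⁺ : ∀ {ℓ} (C : Circuit X ℓ) {u v} → EdgeIn C u v → EdgeIn (image C) (ι u) (ι v)
  edge-image⁺ C (i , j , p , inj₁ (refl , refl)) = i , j , p , inj₁ (refl , refl)
  edge-image⁺ C (i , j , p , inj₂ (refl , refl)) = i , j , p , inj₂ (refl , refl)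

  edge-image⁻ : ∀ {ℓ} (C : Circuit X ℓ) {u v} → EdgeIn (image C) (ι u) (ι v) → EdgeIn C u v
  edge-image⁻ C (i , j , p , inj₁ (q , r)) = i , j , p , inj₁ (ι-injective q , ι-injective r)
  edge-image⁻ C (i , j , p , inj₂ (q , r)) = i , j , p , inj₂ (ι-injective q , ι-injective r)

  edge-image : ∀ {ℓ} (C : Circuit X ℓ) {u v} → EdgeIn (image C) u v →
    ∃₂ λ u′ v′ → u ≡ ι u′ × v ≡ ι v′ × EdgeIn C u′ v′
  edge-image C (i , j , p , inj₁ (q , r)) = at C i , at C j , q , r , i , j , p , inj₁ (refl , refl)
  edge-image C (i , j , p , inj₂ (q , r)) = at C j , at C i , q , r , i , j , p , inj₂ (refl , refl)

  image-⊑⁺ : ∀ {m n} {C : Circuit X m} {D : Circuit X n} → C ⊑ D → image C ⊑ image D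
  image-⊑⁺ {C = C} {D} C⊑D e with u , v , refl , refl , e′ ← edge-image C e = edge-image⁺ D (C⊑D e′)

  image-⊑⁻ : ∀ {m n} {C : Circuit X m} {D : Circuit X n} → image C ⊑ image D → C ⊑ D
  image-⊑⁻ {C = C} {D} C⊑D e = edge-image⁻ D (C⊑D (edge-image⁺ C e))

  preimage : ∀ {ℓ} (D : Circuit Z ℓ) → (∀ i → ∃ λ v → at D i ≡ ι v) → ∃ λ C → image C ≈ᶜ D
  preimage {ℓ} D lift = C
    , (λ { (i , j , p , e) → i , j , p , Sum.map (λ (q , r) → trans q (sym (at≡ i)) , trans r (sym (at≡ j)))
                                                 (λ (q , r) → trans q (sym (at≡ j)) , trans r (sym (at≡ i))) e })
    , (λ { (i , j , p , e) → i , j , p , Sum.map (λ (q , r) → trans q (at≡ i) , trans r (at≡ j))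
                                                 (λ (q , r) → trans q (at≡ j) , trans r (at≡ i)) e })
    where
    at≡ : ∀ i → at D i ≡ ι (proj₁ (lift i))
    at≡ i = proj₂ (lift i)

    C : Circuit X ℓ
    C = record
      { 3≤ℓ       = 3≤ℓ D
      ; at        = λ i → proj₁ (lift i)
      ; injective = λ {i} {j} eq → injective D (trans (at≡ i) (trans (cong ι eq) (sym (at≡ j))))
      ; linked    = λ {i} {j} p → ι-nbrs⁻ (subst₂ (λ u v → u ∈ nbrs Z v) (at≡ j) (at≡ i) (linked D p))
      }

inl : ∀ X Y → Embedding X (X ⊕ Y)
inl X Y = record
  { ι = inj₁ ; ι-injective = inj₁-injective ; ι-nbrs⁺ = ∈-map⁺ inj₁
  ; ι-nbrs⁻ = λ p → let _ , q , eq = ∈-map⁻ inj₁ p in subst (_∈ _) (sym (inj₁-injective eq)) q }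

inr : ∀ X Y → Embedding Y (X ⊕ Y)
inr X Y = record
  { ι = inj₂ ; ι-injective = inj₂-injective ; ι-nbrs⁺ = ∈-map⁺ inj₂
  ; ι-nbrs⁻ = λ p → let _ , q , eq = ∈-map⁻ inj₂ p in subst (_∈ _) (sym (inj₂-injective eq)) q }

open Embedding using (image; edge-image⁺; edge-image; image-⊑⁺; image-⊑⁻; preimage)

-- An arc never changes the summand, so the summand of the first vertex propagates around the
-- circuit.
circuit-⊕ : ∀ {X Y ℓ} (D : Circuit (X ⊕ Y) ℓ) →
  (∀ i → ∃ λ u → at D i ≡ inj₁ u) ⊎ (∀ i → ∃ λ v → at D i ≡ inj₂ v)
circuit-⊕ {ℓ = zero}  D with () ← 3≤ℓ D
circuit-⊕ {X} {Y} {suc n} D with at D zero in eq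
... | inj₁ u = inj₁ (cyclic-induction _ (λ { {i} {j} p (v , eq) →
                 let w , _ , eq′ = ∈-map⁻ inj₁ (subst (λ x → at D j ∈ nbrs (X ⊕ Y) x) eq (linked D p))
                   in w , eq′ }) (u , eq))
... | inj₂ u = inj₂ (cyclic-induction _ (λ { {i} {j} p (v , eq) →
                 let w , _ , eq′ = ∈-map⁻ inj₂ (subst (λ x → at D j ∈ nbrs (X ⊕ Y) x) eq (linked D p))
                   in w , eq′ }) (u , eq))

⊕-count : ∀ {X Y ℓ m n} → CircuitCount X ℓ m → CircuitCount Y ℓ n → CircuitCount (X ⊕ Y) ℓ (m + n)
⊕-count {X} {Y} {ℓ} {m} {n} count count′ = record
  { enumerate = λ k → pick (Inverse.to Finₚ.+↔⊎ k)
  ; separate  = λ {i} {j} eq → trans (sym (Inverse.strictlyInverseʳ (Finₚ.+↔⊎ {m} {n}) i))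
      (trans (cong (Inverse.from (Finₚ.+↔⊎ {m} {n})) (pick-separate (Inverse.to Finₚ.+↔⊎ i) (Inverse.to Finₚ.+↔⊎ j) eq))
        (Inverse.strictlyInverseʳ (Finₚ.+↔⊎ {m} {n}) j))
  ; exhaust   = λ D → let k , C⊑ , ⊑C = pick-exhaust D
                          eq = Inverse.strictlyInverseˡ (Finₚ.+↔⊎ {m} {n}) k in
      Inverse.from (Finₚ.+↔⊎ {m} {n}) k , subst (λ k → pick k ≈ᶜ D) (sym eq) (C⊑ , ⊑C)
  }
  where
  pick : Fin m ⊎ Fin n → Circuit (X ⊕ Y) ℓ
  pick = Sum.[ image (inl X Y) ∘ enumerate count , image (inr X Y) ∘ enumerate count′ ]

  -- Circuits in different summands are told apart by any edge, and every circuit has one.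
  apart : ∀ i j → ¬ (image (inl X Y) (enumerate count i) ⊑ image (inr X Y) (enumerate count′ j))
  apart i j sub with u , v , e ← edge (enumerate count i)
    with _ , _ , () , _ ← edge-image (inr X Y) (enumerate count′ j)
      (sub (edge-image⁺ (inl X Y) (enumerate count i) e))

  pick-separate : ∀ i j → pick i ≈ᶜ pick j → i ≡ j
  pick-separate (inj₁ i) (inj₁ j) (p , q) = cong inj₁ (separate count
    ( image-⊑⁻ (inl X Y) {C = enumerate count i} {enumerate count j} p
    , image-⊑⁻ (inl X Y) {C = enumerate count j} {enumerate count i} q))
  pick-separate (inj₁ i) (inj₂ j) (p , q) = ⊥-elim (apart i j p)
  pick-separate (inj₂ i) (inj₁ j) (p , q) = ⊥-elim (apart j i q)
  pick-separate (inj₂ i) (inj₂ j) (p , q) = cong inj₂ (separate count′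
    ( image-⊑⁻ (inr X Y) {C = enumerate count′ i} {enumerate count′ j} p
    , image-⊑⁻ (inr X Y) {C = enumerate count′ j} {enumerate count′ i} q))

  pick-exhaust : ∀ (D : Circuit (X ⊕ Y) ℓ) → ∃ λ k → pick k ≈ᶜ D
  pick-exhaust D with circuit-⊕ D
  ... | inj₁ left  = let C , C⊑D , D⊑C = preimage (inl X Y) D left
                         i , i⊑C , C⊑i = exhaust count C in
    inj₁ i , (λ e → C⊑D (image-⊑⁺ (inl X Y) {C = enumerate count i} {C} i⊑C e))
           , (λ e → image-⊑⁺ (inl X Y) {C = C} {enumerate count i} C⊑i (D⊑C e))
  ... | inj₂ right = let C , C⊑D , D⊑C = preimage (inr X Y) D right
                         i , i⊑C , C⊑i = exhaust count′ C in
    inj₂ i , (λ e → C⊑D (image-⊑⁺ (inr X Y) {C = enumerate count′ i} {C} i⊑C e))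
           , (λ e → image-⊑⁺ (inr X Y) {C = C} {enumerate count′ i} C⊑i (D⊑C e))

-- Graphs with at most one cycle

argmax : ∀ {n} (f : Fin (suc n) → ℕ) → ∃ λ i → ∀ j → f j ≤ f i
argmax {zero}  f = zero , λ { zero → ℕₚ.≤-refl }
argmax {suc n} f with argmax (f ∘ suc)
... | i , f≤ with ℕₚ.≤-total (f zero) (f (suc i))
...   | inj₁ f₀≤ = suc i , λ { zero → f₀≤ ; (suc j) → f≤ j }
...   | inj₂ f₀≥ = zero , λ { zero → ℕₚ.≤-refl ; (suc j) → ℕₚ.≤-trans (f≤ j) f₀≥ }

-- Removing the vertices in order of decreasing rank removes leaves and isolated
-- vertices only, until the vertices of rank 0 are left.
record Pruning (X : Bigraph) : Set where
  field
    rank   : V X → ℕ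
    parent : V X → V X
    prune  : ∀ {u v} → u ∈ nbrs X v → 0 < rank v → rank u ≤ rank v → u ≡ parent v

  -- Look at a vertex of largest rank on the circuit. If that rank were positive, both neighbours
  -- along the circuit would equal its parent, yet they are distinct.
  circuit-core : ∀ {ℓ} (C : Circuit X ℓ) i → rank (at C i) ≡ 0
  circuit-core {zero}  C i with () ← i
  circuit-core {suc ℓ} C i with argmax (rank ∘ at C)
  ... | k , ≤k with rank (at C k) ℕₚ.≟ 0
  ...   | yes eq  = ℕₚ.n≤0⇒n≡0 (ℕₚ.≤-trans (≤k i) (ℕₚ.≤-reflexive eq))
  ...   | no  neq =
    let j , k→j = next k
        h , h→k = previous k
        0<k = ℕₚ.n≢0⇒n>0 neq
    in contradiction
         (injective C (trans (prune (linked C k→j) 0<k (≤k j)) (sym (prune (nbrs-sym X (linked C h→k)) 0<k (≤k h)))))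
         (next≢previous (3≤ℓ C) k→j h→k)

  forest-count : (∀ v → 0 < rank v) → ∀ {ℓ} → CircuitCount X ℓ 0
  forest-count 0<rank = record
    { enumerate = λ () ; separate = λ { {()} }
    ; exhaust = λ C → ⊥-elim (ℕₚ.<⇒≢ (0<rank _) (sym (circuit-core C (origin C)))) }
    where
    origin : ∀ {ℓ} → Circuit X ℓ → Fin ℓ
    origin {zero}  C with () ← 3≤ℓ C
    origin {suc ℓ} C = zero

  module _
    (≤2 : ∀ v → rank v ≡ 0 → ∃₂ λ x y → ∀ {u} → u ∈ nbrs X v → rank u ≡ 0 → u ≡ x ⊎ u ≡ y)
    where

    -- At a common vertex, the neighbours on C and those on D are the two
    -- neighbours of rank 0.
    follow : ∀ {m n} (C : Circuit X m) (D : Circuit X n) {i i′ j} → at D j ≡ at C i → Next i i′ →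
      ∃ λ j′ → at D j′ ≡ at C i′ × (Next j j′ ⊎ Next j′ j)
    follow {n = zero}  C D {j = ()}
    follow {n = suc n} C D {i} {i′} {j} eq i→i′ =
      let x , y , two = ≤2 (at C i) (circuit-core C i)
          s , j→s = next j
          p , p→j = previous j
          s∈ = subst (λ v → at D s ∈ nbrs X v) eq (linked D j→s)
          p∈ = subst (λ v → at D p ∈ nbrs X v) eq (nbrs-sym X (linked D p→j))
      in choose (next≢previous (3≤ℓ D) j→s p→j) j→s p→j
           (two s∈ (circuit-core D s)) (two p∈ (circuit-core D p)) (two (linked C i→i′) (circuit-core C i′))
      where
      choose : ∀ {x y s p} → s ≢ p → Next j s → Next p j → at D s ≡ x ⊎ at D s ≡ y → at D p ≡ x ⊎ at D p ≡ y →
        at C i′ ≡ x ⊎ at C i′ ≡ y → ∃ λ j′ → at D j′ ≡ at C i′ × (Next j j′ ⊎ Next j′ j)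
      choose s≢p a b (inj₁ s≡) (inj₁ p≡) _         = contradiction (injective D (trans s≡ (sym p≡))) s≢p
      choose s≢p a b (inj₂ s≡) (inj₂ p≡) _         = contradiction (injective D (trans s≡ (sym p≡))) s≢p
      choose s≢p a b (inj₁ s≡) (inj₂ p≡) (inj₁ c≡) = _ , trans s≡ (sym c≡) , inj₁ a
      choose s≢p a b (inj₁ s≡) (inj₂ p≡) (inj₂ c≡) = _ , trans p≡ (sym c≡) , inj₂ b
      choose s≢p a b (inj₂ s≡) (inj₁ p≡) (inj₁ c≡) = _ , trans p≡ (sym c≡) , inj₂ b
      choose s≢p a b (inj₂ s≡) (inj₁ p≡) (inj₂ c≡) = _ , trans s≡ (sym c≡) , inj₁ a

    contained : ∀ {m n} (C : Circuit X m) (D : Circuit X n) {i j} → at D j ≡ at C i →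
      ∀ i → ∃ λ j → at D j ≡ at C i
    contained C D eq = cyclic-induction _ (λ p (j , eq) → let j′ , eq′ , _ = follow C D eq p in j′ , eq′) (_ , eq)

    contained-⊑ : ∀ {m n} (C : Circuit X m) (D : Circuit X n) → (∀ i → ∃ λ j → at D j ≡ at C i) → C ⊑ D
    contained-⊑ C D sub (i , i′ , p , e) with sub i
    ... | j , eq with follow C D eq p
    ...   | j′ , eq′ , inj₁ q = j , j′ , q , Sum.map (λ (a , b) → trans a (sym eq) , trans b (sym eq′))
                                                     (λ (a , b) → trans a (sym eq′) , trans b (sym eq)) e
    ...   | j′ , eq′ , inj₂ q = j′ , j , q , Sum.swap (Sum.map (λ (a , b) → trans a (sym eq) , trans b (sym eq′))
                                                     (λ (a , b) → trans a (sym eq′) , trans b (sym eq)) e)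

    contained-≤ : ∀ {m n} (C : Circuit X m) (D : Circuit X n) → (∀ i → ∃ λ j → at D j ≡ at C i) → m ≤ n
    contained-≤ C D sub = Finₚ.injective⇒≤ {f = proj₁ ∘ sub} λ {i} {j} eq →
      injective C (trans (sym (proj₂ (sub i))) (trans (cong (at D) eq) (proj₂ (sub j))))

    -- All circuits live on the vertices of rank 0, where at most two directions are available, so
    -- two circuits with a common vertex follow each other all the way round. `C` covers all
    -- vertices of rank 0 and thus meets every `D`. Inclusion of vertices both ways gives equal
    -- lengths and equal edges.
    circuit-unique : ∀ {m n} (C : Circuit X m) → (∀ v → rank v ≡ 0 → ∃ λ i → at C i ≡ v) →
      (D : Circuit X n) → m ≡ n × C ≈ᶜ D
    circuit-unique {n = zero}  C cover D with () ← 3≤ℓ D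
    circuit-unique {n = suc n} C cover D =
      ℕₚ.≤-antisym (contained-≤ C D C⊆D) (contained-≤ D C D⊆C) , contained-⊑ C D C⊆D , contained-⊑ D C D⊆C
      where
      common : ∃ λ i → at C i ≡ at D zero
      common = cover (at D zero) (circuit-core D zero)

      C⊆D : ∀ i → ∃ λ j → at D j ≡ at C i
      C⊆D = contained C D (sym (proj₂ common))

      D⊆C : ∀ j → ∃ λ i → at C i ≡ at D j
      D⊆C = contained D C (proj₂ common)

    unicyclic-count : ∀ {m} (C : Circuit X m) → (∀ v → rank v ≡ 0 → ∃ λ i → at C i ≡ v) →
      ∀ ℓ → CircuitCount X ℓ (if does (ℓ ℕₚ.≟ m) then 1 else 0)
    unicyclic-count {m} C cover ℓ = count (ℓ ℕₚ.≟ m)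
      where
      count : (ℓ≟m : Dec (ℓ ≡ m)) → CircuitCount X ℓ (if does ℓ≟m then 1 else 0)
      count (yes refl) = record
        { enumerate = λ _ → C ; separate = λ { {zero} {zero} _ → refl }
        ; exhaust = λ D → zero , proj₂ (circuit-unique C cover D) }
      count (no ℓ≢m) = record
        { enumerate = λ () ; separate = λ { {()} }
        ; exhaust = λ D → ⊥-elim (ℓ≢m (sym (proj₁ (circuit-unique C cover D)))) }

-- Trails

infixr 5 _∷_

data Trail {A : Set} (R : A → A → Set) : A → A → Set where
  [_] : ∀ x → Trail R x x
  _∷_ : ∀ {x y z} → R x y → Trail R y z → Trail R x z

module _ {A : Set} {R : A → A → Set} where

  infixr 5 _▷⟨_⟩_

  edges : ∀ {x y} → Trail R x y → ℕ
  edges [ x ]   = 0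
  edges (r ∷ t) = suc (edges t)

  point : ∀ {x y} (t : Trail R x y) → Fin (suc (edges t)) → A
  point {x} t       zero    = x
  point     (r ∷ t) (suc i) = point t i

  points : ∀ {x y} → Trail R x y → List A
  points [ x ]       = x ∷ []
  points {x} (r ∷ t) = x ∷ points t

  -- The two trails are bridged by an arc instead of sharing a vertex, so their point lists are
  -- simply appended and no point is listed twice by the gluing itself.
  _▷⟨_⟩_ : ∀ {x y z w} → Trail R x y → R y z → Trail R z w → Trail R x w
  [ x ]   ▷⟨ r ⟩ t = r ∷ t
  (q ∷ s) ▷⟨ r ⟩ t = q ∷ (s ▷⟨ r ⟩ t)

  points-▷ : ∀ {x y z w} (s : Trail R x y) {r : R y z} {t : Trail R z w} →
    points (s ▷⟨ r ⟩ t) ≡ points s ++ points t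
  points-▷ [ x ]   = refl
  points-▷ (q ∷ s) = cong (_ ∷_) (points-▷ s)

  length-points : ∀ {x y} (t : Trail R x y) → length (points t) ≡ suc (edges t)
  length-points [ x ]   = refl
  length-points (r ∷ t) = cong suc (length-points t)

  point-last : ∀ {x y} (t : Trail R x y) → point t (fromℕ (edges t)) ≡ y
  point-last [ x ]   = refl
  point-last (r ∷ t) = point-last t

  point-step : ∀ {x y} (t : Trail R x y) {i j} → toℕ j ≡ suc (toℕ i) → R (point t i) (point t j)
  point-step (r ∷ t) {zero}  {suc zero} eq = r
  point-step (r ∷ t) {suc i} {suc j}    eq = point-step t (ℕₚ.suc-injective eq)

  point-∈ : ∀ {x y} (t : Trail R x y) i → point t i ∈ points t
  point-∈ [ x ]   zero    = here refl
  point-∈ (r ∷ t) zero    = here refl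
  point-∈ (r ∷ t) (suc i) = there (point-∈ t i)

  ∈-point : ∀ {x y} (t : Trail R x y) {v} → v ∈ points t → ∃ λ i → point t i ≡ v
  ∈-point [ x ]   (here refl) = zero , refl
  ∈-point (r ∷ t) (here refl) = zero , refl
  ∈-point (r ∷ t) (there v∈)  = let i , eq = ∈-point t v∈ in suc i , eq

  point-injective : ∀ {x y} (t : Trail R x y) → Unique (points t) → ∀ {i j} → point t i ≡ point t j → i ≡ j
  point-injective t       u          {zero}  {zero}  eq = refl
  point-injective (r ∷ t) (x∉ ∷ u)   {zero}  {suc j} eq = contradiction eq (All.lookup x∉ (point-∈ t j))
  point-injective (r ∷ t) (x∉ ∷ u)   {suc i} {zero}  eq = contradiction (sym eq) (All.lookup x∉ (point-∈ t i))
  point-injective (r ∷ t) (_ ∷ u)    {suc i} {suc j} eq = cong suc (point-injective t u eq)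

mapTrail : ∀ {A B : Set} {R : A → A → Set} {S : B → B → Set} (f : A → B) → (∀ {x y} → R x y → S (f x) (f y)) →
  ∀ {x y} → Trail R x y → Trail S (f x) (f y)
mapTrail f g [ x ]   = [ f x ]
mapTrail f g (r ∷ t) = g r ∷ mapTrail f g t

points-mapTrail : ∀ {A B : Set} {R : A → A → Set} {S : B → B → Set} (f : A → B)
  (g : ∀ {x y} → R x y → S (f x) (f y)) →
  ∀ {x y} (t : Trail R x y) → points (mapTrail {S = S} f g t) ≡ map f (points t)
points-mapTrail f g [ x ]   = refl
points-mapTrail f g (r ∷ t) = cong (_ ∷_) (points-mapTrail f g t)

Arc : (X : Bigraph) → V X → V X → Set
Arc X u v = v ∈ nbrs X u

closeTrail : ∀ {X ℓ x y} (t : Trail (Arc X) x y) → Arc X y x → Unique (points t) →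
  length (points t) ≡ ℓ → 3 ≤ ℓ → Circuit X ℓ
-- Matching makes `ℓ` literally `suc (edges t)`, the number of points, so that `point t` has the
-- type of a closed walk of length `ℓ`. Callers can still prescribe `ℓ` as a formula in `H`.
closeTrail {X} {ℓ} {x} {y} t closing uniq eq 3≤ with refl ← trans (sym eq) (length-points t) = record
  { 3≤ℓ = 3≤ ; at = point t ; injective = point-injective t uniq
  ; linked = λ { (inj₁ j≡) → point-step t j≡
               ; {i} {j} (inj₂ (i≡ , j≡)) → subst₂ (Arc X)
                   (sym (trans (cong (point t) (Finₚ.toℕ-injective (trans (ℕₚ.suc-injective i≡) (sym (Finₚ.toℕ-fromℕ _)))))
                       (point-last t)))
                   (cong (point t) (Finₚ.toℕ-injective {i = zero} (sym j≡))) closing } }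

closeTrail-cover : ∀ {X ℓ x y} (t : Trail (Arc X) x y) (closing : Arc X y x) (uniq : Unique (points t))
  (eq : length (points t) ≡ ℓ) (3≤ : 3 ≤ ℓ) {v} → v ∈ points t →
    ∃ λ i → at (closeTrail {X} t closing uniq eq 3≤) i ≡ v
closeTrail-cover t closing uniq eq 3≤ v∈ with refl ← trans (sym eq) (length-points t) = ∈-point t v∈

-- The path 0, 1, …, H, seen from either end

parity : ℕ → Bool
parity zero    = false
parity (suc n) = not (parity n)

flip : ∀ {n} → Bool → Fin n → Fin n
flip false p = p
flip true  p = opposite p

flip-involutive : ∀ {n} b (p : Fin n) → flip b (flip b p) ≡ p
flip-involutive false p = refl
flip-involutive true  p = Finₚ.opposite-involutive p

flip-injective : ∀ {n} b {p q : Fin n} → flip b p ≡ flip b q → p ≡ q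
flip-injective b eq = trans (sym (flip-involutive b _)) (trans (cong (flip b) eq) (flip-involutive b _))

below : ∀ {n} → Fin (suc n) → List (Fin (suc n))
below zero            = []
below {suc n} (suc p) = inject₁ p ∷ []

∈-below⁻ : ∀ {n} {p q : Fin (suc n)} → q ∈ below p → toℕ p ≡ suc (toℕ q)
∈-below⁻ {suc n} {suc p} (here refl) = cong suc (sym (Finₚ.toℕ-inject₁ p))

∈-below⁺ : ∀ {n} {p q : Fin (suc n)} → toℕ p ≡ suc (toℕ q) → q ∈ below p
∈-below⁺ {suc n} {suc p} eq = here (Finₚ.toℕ-injective (trans (sym (ℕₚ.suc-injective eq)) (sym (Finₚ.toℕ-inject₁ p))))

module _ {H : ℕ} where

  term : Bool → Fin (suc H)
  term b = flip b zero

  dist : Bool → Fin (suc H) → ℕ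
  dist b p = toℕ (flip b p)

  -- The neighbour one step nearer to the end `b`, with the empty list at that end. Sorting
  -- neighbours by the end that they approach lets one argument serve both ends.
  toward : Bool → Fin (suc H) → List (Fin (suc H))
  toward b p = map (flip b) (below (flip b p))

  ∈-toward⁻ : ∀ b {p q} → q ∈ toward b p → dist b p ≡ suc (dist b q)
  ∈-toward⁻ b q∈ with r , r∈ , refl ← ∈-map⁻ (flip b) q∈ =
    trans (∈-below⁻ r∈) (cong (suc ∘ toℕ) (sym (flip-involutive b r)))

  ∈-toward⁺ : ∀ b {p q} → dist b p ≡ suc (dist b q) → q ∈ toward b p
  ∈-toward⁺ b {p} {q} eq = subst (_∈ toward b p) (flip-involutive b q) (∈-map⁺ (flip b) (∈-below⁺ eq))

  toward-unique : ∀ b p → Unique (toward b p)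
  toward-unique b p = Unique.map⁺ (flip-injective b) (below-unique (flip b p))
    where
    below-unique : ∀ {n} (p : Fin (suc n)) → Unique (below p)
    below-unique zero            = []
    below-unique {suc n} (suc p) = [] ∷ []

  dist-+ : ∀ b p → dist b p + dist (not b) p ≡ H
  dist-+ false p = trans (cong (toℕ p +_) (Finₚ.opposite-prop p)) (ℕₚ.m+[n∸m]≡n (ℕₚ.≤-pred (Finₚ.toℕ<n p)))
  dist-+ true  p = trans (ℕₚ.+-comm (toℕ (opposite p)) (toℕ p)) (dist-+ false p)

  dist-term : ∀ b → dist b (term b) ≡ 0
  dist-term b = cong toℕ (flip-involutive b zero)

  dist-0 : ∀ b {p} → dist b p ≡ 0 → p ≡ term b
  dist-0 b eq = flip-injective b (Finₚ.toℕ-injective (trans eq (sym (dist-term b))))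

  dist-not-term : ∀ b → dist b (term (not b)) ≡ H
  dist-not-term b = trans (sym (ℕₚ.+-identityʳ _)) (trans (cong (dist b (term (not b)) +_) (sym (dist-term (not b))))
    (dist-+ b (term (not b))))

  flip-last : ∀ b → flip b (fromℕ H) ≡ term (not b)
  flip-last false = refl
  flip-last true  = Finₚ.opposite-involutive zero

  -- The distances to the two ends always add up to `H`, so what is gained at one end is lost at the
  -- other.
  dist-not : ∀ b {p q} → dist b p ≡ suc (dist b q) → dist (not b) q ≡ suc (dist (not b) p)
  dist-not b {p} {q} eq = ℕₚ.+-cancelˡ-≡ (dist b q) _ _ (trans (dist-+ b q) (trans (sym (dist-+ b p))
    (trans (cong (_+ dist (not b) p) eq) (sym (ℕₚ.+-suc (dist b q) _)))))

  dist-<-not : ∀ b b′ {p q} → dist b′ p ≡ suc (dist b′ q) → b′ ≡ b ⊎ dist b q ≡ suc (dist b p)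
  dist-<-not false false eq = inj₁ refl
  dist-<-not true  true  eq = inj₁ refl
  dist-<-not false true {p} {q} eq = inj₂ (dist-not true {p} {q} eq)
  dist-<-not true false {p} {q} eq = inj₂ (dist-not false {p} {q} eq)

  along-nbrs : Fin (suc H) → List (Fin (suc H))
  along-nbrs p = toward false p ++ toward true p

  ∈-along⁻ : ∀ {p q} → q ∈ along-nbrs p → ∃ λ b → dist b p ≡ suc (dist b q)
  ∈-along⁻ {p} q∈ = Sum.[ (λ r → false , ∈-toward⁻ false {p} r) , (λ r → true , ∈-toward⁻ true {p} r) ]
    (∈-++⁻ (toward false p) q∈)

  ∈-along⁺ : ∀ b {p q} → dist b p ≡ suc (dist b q) → q ∈ along-nbrs p
  ∈-along⁺ false {p} {q} eq = ∈-++⁺ˡ (∈-toward⁺ false {p} {q} eq)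
  ∈-along⁺ true  {p} {q} eq = ∈-++⁺ʳ (toward false p) (∈-toward⁺ true {p} {q} eq)

  along-unique : ∀ p → Unique (along-nbrs p)
  along-unique p = Unique.++⁺ (toward-unique false p) (toward-unique true p) λ {q} (q∈ , q∈′) →
    -- A vertex nearer than `p` to both ends would give `toℕ p ≡ 2 + toℕ p`.
    ℕₚ.m≢1+n+m (toℕ p) {1} (trans (∈-toward⁻ false {p} {q} q∈)
      (cong suc (dist-not true {p} {q} (∈-toward⁻ true {p} {q} q∈′))))

  toward-length : ∀ b p → length (toward b p) ≡ (if does (p Finₚ.≟ term b) then 0 else 1)
  toward-length b p with p Finₚ.≟ term b
  ... | yes refl rewrite flip-involutive b (zero {H}) = refl
  ... | no  p≢   = trans (length-map (flip b) (below (flip b p)))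
      (below-length (flip b p) λ eq → p≢ (trans (sym (flip-involutive b p)) (cong (flip b) eq)))
    where
    below-length : ∀ {n} (p : Fin (suc n)) → p ≢ zero → length (below p) ≡ 1
    below-length zero            p≢0 = contradiction refl p≢0
    below-length {suc n} (suc p) p≢0 = refl

  parity-dist : ∀ {p q : Fin (suc H)} b → dist b p ≡ suc (dist b q) → parity (toℕ q) ≢ parity (toℕ p)
  parity-dist false eq par = not-¬ (sym par) (cong parity eq)
  parity-dist {p} {q} true eq par = not-¬ par (cong parity (dist-not true {p} {q} eq))

-- Copies of a path of H + 1 vertices, with further vertices of degree 2
-- joining their ends: for the new vertex e, the entry (b , i) stands for the
-- first (b = false) or the last (b = true) vertex of the i-th copy.

Wiring : ℕ → ℕ → Set
Wiring N M = Fin M → (Bool × Fin N) × (Bool × Fin N)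

module _ {N M : ℕ} (c : Wiring N M) where

  infix 4 _≟ᵗ_
  _≟ᵗ_ : (s t : Bool × Fin N) → Dec (s ≡ t)
  _≟ᵗ_ = ×-≡-dec _≟ᵇ_ Finₚ._≟_

  incident : Bool → Fin N → Fin M → Bool
  incident b i e = does ((b , i) ≟ᵗ proj₁ (c e)) ∨ does ((b , i) ≟ᵗ proj₂ (c e))

  incident⁻ : ∀ {b i e} → T (incident b i e) → (b , i) ≡ proj₁ (c e) ⊎ (b , i) ≡ proj₂ (c e)
  incident⁻ {b} {i} {e} t with (b , i) ≟ᵗ proj₁ (c e) | (b , i) ≟ᵗ proj₂ (c e)
  ... | yes p | _     = inj₁ p
  ... | no  _ | yes q = inj₂ q

  midsAt : Bool → Fin N → List (Fin M)
  midsAt b i = filterᵇ (incident b i) (allFin M)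

  copiesAt : Bool → Fin M → List (Fin N)
  copiesAt b e = filterᵇ (λ i → incident b i e) (allFin N)

  -- This fails exactly when the two entries of some new vertex coincide, since `copiesAt` lists
  -- every end once.
  Proper : Set
  Proper = ∀ e → length (copiesAt false e) + length (copiesAt true e) ≡ 2

pattern copy i p = inj₁ (i , p)
pattern mid e    = inj₂ e

module Wired (H : ℕ) (0<H : 0 < H) (even : parity H ≡ false) {N M : ℕ} (c : Wiring N M) where

  Node : Set
  Node = (Fin N × Fin (suc H)) ⊎ Fin M

  portMids : Bool → Fin N → Fin (suc H) → List (Fin M)
  portMids b i p = if does (p Finₚ.≟ term b) then midsAt c b i else []

  wiredNbrs : Node → List Node
  wiredNbrs (copy i p) = map (copy i) (along-nbrs p) ++ (map mid (portMids false i p) ++ map mid (portMids true i p))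
  wiredNbrs (mid e)    = map (λ i → copy i (term false)) (copiesAt c false e) ++
                         map (λ i → copy i (term true)) (copiesAt c true e)

  -- Adjacency with one constructor per kind of arc, so that symmetry, the colouring and pruning are
  -- case distinctions on arcs instead of on positions in concatenated lists.
  data Joined : Node → Node → Set where
    along : ∀ b {i p q} → dist b p ≡ suc (dist b q) → Joined (copy i q) (copy i p)
    out   : ∀ b {i e} → T (incident c b i e) → Joined (mid e) (copy i (term b))
    into  : ∀ b {i e} → T (incident c b i e) → Joined (copy i (term b)) (mid e)

  term-≢ : ∀ b → term {H} b ≢ term (not b)
  term-≢ b eq = ℕₚ.<⇒≢ 0<H (trans (sym (dist-term b)) (trans (cong (dist b) eq) (dist-not-term b)))

  ∈-portMids⁻ : ∀ b {i p e} → e ∈ portMids b i p → Joined (mid e) (copy i p)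
  ∈-portMids⁻ b {i} {p} {e} e∈ with p Finₚ.≟ term b
  ... | yes refl = out b (proj₂ (∈-filter⁻ (T? ∘ incident c b i) {xs = allFin M} e∈))
  ∈-portMids⁻ b () | no _

  ∈-portMids⁺ : ∀ b {i e p} → p ≡ term b → T (incident c b i e) → e ∈ portMids b i p
  ∈-portMids⁺ b {i} {e} {p} eq t with p Finₚ.≟ term b
  ... | yes _ = ∈-filter⁺ (T? ∘ incident c b i) (∈-allFin e) t
  ... | no ≢  = contradiction eq ≢

  joined⁻ : ∀ {u} v → u ∈ wiredNbrs v → Joined u v
  joined⁻ (copy i p) u∈ with ∈-++⁻ (map (copy i) (along-nbrs p)) u∈
  ... | inj₁ r with q , q∈ , refl ← ∈-map⁻ (copy i) r = let b , eq = ∈-along⁻ {p = p} q∈ in along b {p = p} {q} eq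
  ... | inj₂ r with ∈-++⁻ (map mid (portMids false i p)) r
  ...   | inj₁ s with e , e∈ , refl ← ∈-map⁻ mid s = ∈-portMids⁻ false e∈
  ...   | inj₂ s with e , e∈ , refl ← ∈-map⁻ mid s = ∈-portMids⁻ true e∈
  joined⁻ (mid e) u∈ with ∈-++⁻ (map (λ i → copy i (term false)) (copiesAt c false e)) u∈
  ... | inj₁ r with i , i∈ , refl ← ∈-map⁻ (λ i → copy i (term false)) r =
    into false (proj₂ (∈-filter⁻ (λ i → T? (incident c false i e)) {xs = allFin N} i∈))
  ... | inj₂ r with i , i∈ , refl ← ∈-map⁻ (λ i → copy i (term true)) r =
    into true (proj₂ (∈-filter⁻ (λ i → T? (incident c true i e)) {xs = allFin N} i∈))

  joined⁺ : ∀ {u v} → Joined u v → u ∈ wiredNbrs v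
  joined⁺ (along b {i} {p} {q} eq) = ∈-++⁺ˡ (∈-map⁺ (copy i) (∈-along⁺ b {p} {q} eq))
  joined⁺ (out false {i} t) = ∈-++⁺ʳ (map (copy i) (along-nbrs (term false)))
    (∈-++⁺ˡ (∈-map⁺ mid (∈-portMids⁺ false refl t)))
  joined⁺ (out true {i} t)  = ∈-++⁺ʳ (map (copy i) (along-nbrs (term true)))
    (∈-++⁺ʳ (map mid (portMids false i (term true))) (∈-map⁺ mid (∈-portMids⁺ true refl t)))
  joined⁺ (into false {e = e} t) = ∈-++⁺ˡ (∈-map⁺ (λ i → copy i (term false))
    (∈-filter⁺ (λ i → T? (incident c false i e)) (∈-allFin _) t))
  joined⁺ (into true {e = e} t) = ∈-++⁺ʳ (map (λ i → copy i (term false)) (copiesAt c false e))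
    (∈-map⁺ (λ i → copy i (term true)) (∈-filter⁺ (λ i → T? (incident c true i e)) (∈-allFin _) t))

  joined-sym : ∀ {u v} → Joined u v → Joined v u
  joined-sym (along b {p = p} {q} eq) = along (not b) {p = q} {p} (dist-not b {p} {q} eq)
  joined-sym (out b t)  = into b t
  joined-sym (into b t) = out b t

  copy-injective : ∀ {i} {p q : Fin (suc H)} → _≡_ {A = Node} (copy i p) (copy i q) → p ≡ q
  copy-injective refl = refl

  wired-unique : ∀ v → Unique (wiredNbrs v)
  wired-unique (copy i p) = Unique.++⁺ (Unique.map⁺ copy-injective (along-unique p))
    (Unique.++⁺ (Unique.map⁺ inj₂-injective (port-unique false)) (Unique.map⁺ inj₂-injective (port-unique true))
      separate-mids)
    separate-copies
    where
    port-unique : ∀ b → Unique (portMids b i p)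
    port-unique b with p Finₚ.≟ term b
    ... | yes _ = Unique.filter⁺ (T? ∘ incident c b i) (Unique.allFin⁺ M)
    ... | no  _ = []

    at-term : ∀ b {e} → e ∈ portMids b i p → p ≡ term b
    at-term b e∈ with p Finₚ.≟ term b
    ... | yes eq = eq
    at-term b () | no _

    separate-mids : ∀ {v} → ¬ (v ∈ map mid (portMids false i p) × v ∈ map mid (portMids true i p))
    separate-mids (r , s) with e , e∈ , _ ← ∈-map⁻ mid r | f , f∈ , _ ← ∈-map⁻ mid s =
      term-≢ false (trans (sym (at-term false e∈)) (at-term true f∈))

    separate-copies : ∀ {v} → ¬ (v ∈ map (copy i) (along-nbrs p)
      × v ∈ map mid (portMids false i p) ++ map mid (portMids true i p))
    separate-copies (r , s) with q , _ , refl ← ∈-map⁻ (copy i) r | ∈-++⁻ (map mid (portMids false i p)) s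
    ... | inj₁ s′ with _ , _ , () ← ∈-map⁻ mid s′
    ... | inj₂ s′ with _ , _ , () ← ∈-map⁻ mid s′
  wired-unique (mid e) = Unique.++⁺
    (Unique.map⁺ (cong proj₁ ∘ inj₁-injective) (Unique.filter⁺ (λ i → T? (incident c false i e)) (Unique.allFin⁺ N)))
    (Unique.map⁺ (cong proj₁ ∘ inj₁-injective) (Unique.filter⁺ (λ i → T? (incident c true i e)) (Unique.allFin⁺ N)))
    separate-ends
    where
    separate-ends : ∀ {v} → ¬ (v ∈ map (λ i → copy i (term false)) (copiesAt c false e)
      × v ∈ map (λ i → copy i (term true)) (copiesAt c true e))
    separate-ends (r , s) with _ , _ , refl ← ∈-map⁻ (λ i → copy i (term false)) r
      | _ , _ , eq ← ∈-map⁻ (λ i → copy i (term true)) s =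
      term-≢ false (cong proj₂ (inj₁-injective eq))

  wiredColour : Node → Bool
  wiredColour (copy i p) = parity (toℕ p)
  wiredColour (mid e)    = true

  -- Evenness of `H` puts both ends of every copy on the side `false`. The new vertices can then
  -- take the side `true`, and a copy vertex on that side is always interior, hence of degree 2.
  colour-term : ∀ b → parity (toℕ (term {H} b)) ≡ false
  colour-term false = refl
  colour-term true  = trans (cong parity (Finₚ.toℕ-fromℕ H)) even

  joined-colour : ∀ {u v} → Joined u v → wiredColour u ≢ wiredColour v
  joined-colour (along b {p = p} {q} eq) = parity-dist {p = p} {q} b eq
  joined-colour (out b t) eq  with () ← trans eq (colour-term b)
  joined-colour (into b t) eq with () ← trans (sym eq) (colour-term b)

  wired-degree : ∀ i p → length (wiredNbrs (copy i p)) ≡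
    (length (toward false p) + length (toward true p)) + (length (portMids false i p) + length (portMids true i p))
  wired-degree i p = trans (length-++ (map (copy i) (along-nbrs p))) (cong₂ _+_
    (trans (length-map (copy i) (along-nbrs p)) (length-++ (toward false p)))
    (trans (length-++ (map mid (portMids false i p)))
      (cong₂ _+_ (length-map mid (portMids false i p)) (length-map mid (portMids true i p)))))

  wired-binary : Proper c → ∀ v → wiredColour v ≡ true → length (wiredNbrs v) ≡ 2
  wired-binary proper (mid e) _ = trans (length-++ (map (λ i → copy i (term false)) (copiesAt c false e)))
    (trans (cong₂ _+_ (length-map (λ i → copy i (term false)) (copiesAt c false e))
                (length-map (λ i → copy i (term true)) (copiesAt c true e))) (proper e))
  wired-binary proper (copy i p) odd = trans (wired-degree i p) (cong₂ _+_
    (cong₂ _+_ (inner false) (inner true)) (cong₂ _+_ (cong length (no-mids false)) (cong length (no-mids true))))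
    where
    p≢ : ∀ b → does (p Finₚ.≟ term b) ≡ false
    p≢ b with p Finₚ.≟ term b
    ... | no _ = refl
    ... | yes refl with () ← trans (sym odd) (colour-term b)

    inner : ∀ b → length (toward b p) ≡ 1
    inner b = trans (toward-length b p) (cong (if_then 0 else 1) (p≢ b))

    no-mids : ∀ b → portMids b i p ≡ []
    no-mids b = cong (if_then midsAt c b i else []) (p≢ b)

  wired : Proper c → Bigraph
  wired proper = record
    { V           = Node
    ; size        = N * suc H + M
    ; enum        = Symmetry.inverse (Compose.inverse Finₚ.+↔⊎ (Finₚ.*↔× {N} {suc H} ⊎-↔ Identity.↔-id (Fin M)))
    ; nbrs        = wiredNbrs
    ; nbrs-unique = wired-unique
    ; nbrs-sym    = λ {u} {v} u∈ → joined⁺ (joined-sym (joined⁻ v u∈))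
    ; colour      = wiredColour
    ; colour-≢    = λ {u} {v} u∈ → joined-colour (joined⁻ v u∈)
    ; binary      = wired-binary proper
    }

-- Rational matrices acting on real vectors

Matrixℚ : ℕ → ℕ → Set
Matrixℚ m n = Fin m → Fin n → ℚ

sumℚ : ∀ {n} → (Fin n → ℚ) → ℚ
sumℚ = Vector.foldr ℚ._+_ 0ℚ

infixl 7 _⊗_
infix 4 _≗ᵐ_

_⊗_ : ∀ {l m n} → Matrixℚ l m → Matrixℚ m n → Matrixℚ l n
(A ⊗ B) i k = sumℚ λ j → A i j ℚ.* B j k

transposed : ∀ {m n} → Matrixℚ m n → Matrixℚ n m
transposed A j i = A i j

bit : Bool → ℚ
bit b = if b then 1ℚ else 0ℚ

identity : ∀ {n} → Matrixℚ n n
identity i j = bit (does (j Finₚ.≟ i))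

_≗ᵐ_ : ∀ {m n} → Matrixℚ m n → Matrixℚ m n → Set
A ≗ᵐ B = ∀ i j → A i j ≡ B i j

apply : ∀ {m n} → Matrixℚ m n → (Fin n → ℝ) → Fin m → ℝ
apply A f i = sumℝ λ j → fromℚ (A i j) *ℝ f j

fromℚ-sum : ∀ {n} (f : Fin n → ℚ) → sumℝ (fromℚ ∘ f) ≃ fromℚ (sumℚ f)
fromℚ-sum {zero}  f = ≃-refl
fromℚ-sum {suc n} f = ≃-trans (+-cong ≃-refl (fromℚ-sum (f ∘ suc))) (≃-pointwise λ _ → refl)

fromℚ-bit : ∀ b → fromℚ (bit b) ≃ indicator b
fromℚ-bit true  = ≃-refl
fromℚ-bit false = ≃-refl

apply-linear : ∀ {m n} (A : Matrixℚ m n) → IsLinear (apply A)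
apply-linear A = record
  { φ-cong = λ f≃g i → sum-cong-≋ λ j → *-cong ≃-refl (f≃g j)
  ; φ-+    = λ f g i → ≃-trans (sum-cong-≋ λ j → distribˡ (fromℚ (A i j)) (f j) (g j))
      (∑-distrib-+ (λ j → fromℚ (A i j) *ℝ f j) _)
  ; φ-*    = λ c f i → ≃-trans (sum-cong-≋ λ j → begin
      fromℚ (A i j) *ℝ (c *ℝ f j)   ≈⟨ ≃-sym (*-assoc (fromℚ (A i j)) c (f j)) ⟩
      (fromℚ (A i j) *ℝ c) *ℝ f j   ≈⟨ *-cong (*-comm (fromℚ (A i j)) c) ≃-refl ⟩
      (c *ℝ fromℚ (A i j)) *ℝ f j   ≈⟨ *-assoc c (fromℚ (A i j)) (f j) ⟩
      c *ℝ (fromℚ (A i j) *ℝ f j)   ∎) (≃-sym (*-distribˡ-sum c λ j → fromℚ (A i j) *ℝ f j))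
  }

apply-≗ : ∀ {m n} {A B : Matrixℚ m n} → A ≗ᵐ B → ∀ f i → apply A f i ≃ apply B f i
apply-≗ A≗B f i = sum-cong-≋ λ j → *-cong (≃-reflexive (cong fromℚ (A≗B i j))) ≃-refl

apply-identity : ∀ {n} (f : Fin n → ℝ) i → apply identity f i ≃ f i
apply-identity f i = ≃-trans (sum-cong-≋ λ j → *-cong (fromℚ-bit (does (j Finₚ.≟ i))) ≃-refl) (sum-δ i f)

apply-⊗ : ∀ {l m n} (A : Matrixℚ l m) (B : Matrixℚ m n) f i → apply A (apply B f) i ≃ apply (A ⊗ B) f i
apply-⊗ A B f i = begin
  sumℝ (λ j → fromℚ (A i j) *ℝ sumℝ (λ k → fromℚ (B j k) *ℝ f k))
    ≈⟨ sum-cong-≋ (λ j → *-distribˡ-sum (fromℚ (A i j)) λ k → fromℚ (B j k) *ℝ f k) ⟩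
  sumℝ (λ j → sumℝ (λ k → fromℚ (A i j) *ℝ (fromℚ (B j k) *ℝ f k)))
    ≈⟨ ∑-comm (λ j k → fromℚ (A i j) *ℝ (fromℚ (B j k) *ℝ f k)) ⟩
  sumℝ (λ k → sumℝ (λ j → fromℚ (A i j) *ℝ (fromℚ (B j k) *ℝ f k)))
    ≈⟨ sum-cong-≋ (λ k → sum-cong-≋ λ j → ≃-trans (≃-sym (*-assoc (fromℚ (A i j)) (fromℚ (B j k)) (f k)))
         (*-cong (≃-pointwise λ _ → refl) ≃-refl)) ⟩
  sumℝ (λ k → sumℝ (λ j → fromℚ (A i j ℚ.* B j k) *ℝ f k))
    ≈⟨ sum-cong-≋ (λ k → ≃-sym (*-distribʳ-sum (f k) λ j → fromℚ (A i j ℚ.* B j k))) ⟩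
  sumℝ (λ k → sumℝ (λ j → fromℚ (A i j ℚ.* B j k)) *ℝ f k)
    ≈⟨ sum-cong-≋ (λ k → *-cong (fromℚ-sum λ j → A i j ℚ.* B j k) ≃-refl) ⟩
  sumℝ (λ k → fromℚ (sumℚ λ j → A i j ℚ.* B j k) *ℝ f k) ∎

apply-intertwine : ∀ {l m m′ n} (A : Matrixℚ l m) (B : Matrixℚ m n) (A′ : Matrixℚ l m′) (B′ : Matrixℚ m′ n) →
  A ⊗ B ≗ᵐ A′ ⊗ B′ → ∀ f i → apply A (apply B f) i ≃ apply A′ (apply B′ f) i
apply-intertwine A B A′ B′ eq f i = ≃-trans (apply-⊗ A B f i) (≃-trans (apply-≗ eq f i) (≃-sym (apply-⊗ A′ B′ f i)))

Σᴸ-filter : ∀ {n} (p : Fin n → Bool) (f : Fin n → ℝ) →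
  Σᴸ (map f (filterᵇ p (allFin n))) ≃ sumℝ λ j → fromℚ (bit (p j)) *ℝ f j
Σᴸ-filter {n} p f = go n id
  where
  -- `allFin n` is `tabulate id`; the induction needs an arbitrary tabulated function in place of
  -- `id`.
  go : ∀ k (g : Fin k → Fin n) → Σᴸ (map f (filterᵇ p (tabulate g))) ≃ sumℝ λ j → fromℚ (bit (p (g j))) *ℝ f (g j)
  go zero    g = ≃-refl
  go (suc k) g with p (g zero)
  ... | true  = +-cong (≃-sym (*-identityˡ _)) (go k (g ∘ suc))
  ... | false = ≃-trans (go k (g ∘ suc)) (≃-sym (≃-trans (+-cong (zeroˡ _) ≃-refl) (+-identityˡ _)))

incidence : ∀ {N M} → Wiring N M → Bool → Matrixℚ N M
incidence c b i e = bit (incident c b i e)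

-- An invertible change of basis in the spaces of copies and of joining vertices
-- that carries the incidence matrices of one wiring to those of the other.
record Transplantation {N M} (c c′ : Wiring N M) : Set where
  field
    P P⁻¹  : Matrixℚ N N
    R R⁻¹  : Matrixℚ M M
    PP⁻¹   : P ⊗ P⁻¹ ≗ᵐ identity
    P⁻¹P   : P⁻¹ ⊗ P ≗ᵐ identity
    RR⁻¹   : R ⊗ R⁻¹ ≗ᵐ identity
    R⁻¹R   : R⁻¹ ⊗ R ≗ᵐ identity
    copies : ∀ b → P ⊗ incidence c b ≗ᵐ incidence c′ b ⊗ R
    mids   : ∀ b → R ⊗ transposed (incidence c b) ≗ᵐ transposed (incidence c′ b) ⊗ P

-- Similarity of two wirings related by a transplantation

module Rewire (H : ℕ) (0<H : 0 < H) (even : parity H ≡ false) {N M : ℕ} where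

  module _ (c : Wiring N M) where

    open Wired H 0<H even c

    midPart : Bool → (Node → ℝ) → Fin N → Fin (suc H) → ℝ
    midPart b f i p = if does (p Finₚ.≟ term b) then apply (incidence c b) (f ∘ mid) i else 0ℝ

    operator-copy : ∀ f i p → Σᴸ (map f (wiredNbrs (copy i p))) ≃
      Σᴸ (map (λ q → f (copy i q)) (along-nbrs p)) +ℝ (midPart false f i p +ℝ midPart true f i p)
    operator-copy f i p = begin
      Σᴸ (map f (map (copy i) (along-nbrs p) ++ (map mid (portMids false i p) ++ map mid (portMids true i p))))
        ≈⟨ split (map (copy i) (along-nbrs p)) _ ⟩
      Σᴸ (map f (map (copy i) (along-nbrs p)))
        +ℝ Σᴸ (map f (map mid (portMids false i p) ++ map mid (portMids true i p)))
        ≈⟨ +-cong (≃-reflexive (cong Σᴸ (sym (map-∘ (along-nbrs p)))))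
             (≃-trans (split (map mid (portMids false i p)) _)
             (+-cong (port false) (port true))) ⟩
      _ ∎
      where
      split : ∀ xs ys → Σᴸ (map f (xs ++ ys)) ≃ Σᴸ (map f xs) +ℝ Σᴸ (map f ys)
      split xs ys = ≃-trans (≃-reflexive (cong Σᴸ (map-++ f xs ys))) (Σᴸ-++ (map f xs) (map f ys))

      port : ∀ b → Σᴸ (map f (map mid (portMids b i p))) ≃ midPart b f i p
      port b with does (p Finₚ.≟ term b)
      ... | false = ≃-refl
      ... | true  = ≃-trans (≃-reflexive (cong Σᴸ (sym (map-∘ (midsAt c b i)))))
                (Σᴸ-filter (incident c b i) (f ∘ mid))

    operator-mid : ∀ f e → Σᴸ (map f (wiredNbrs (mid e))) ≃
      apply (transposed (incidence c false)) (λ i → f (copy i (term false))) e +ℝ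
      apply (transposed (incidence c true)) (λ i → f (copy i (term true))) e
    operator-mid f e = begin
      Σᴸ (map f (ends false ++ ends true))
        ≈⟨ ≃-reflexive (cong Σᴸ (map-++ f (ends false) (ends true))) ⟩
      Σᴸ (map f (ends false) ++ map f (ends true))
        ≈⟨ Σᴸ-++ (map f (ends false)) (map f (ends true)) ⟩
      Σᴸ (map f (ends false)) +ℝ Σᴸ (map f (ends true))
        ≈⟨ +-cong (end false) (end true) ⟩
      _ ∎
      where
      ends : Bool → List Node
      ends b = map (λ i → copy i (term b)) (copiesAt c b e)

      end : ∀ b → Σᴸ (map f (ends b)) ≃ apply (transposed (incidence c b)) (λ i → f (copy i (term b))) e
      end b = ≃-trans (≃-reflexive (cong Σᴸ (sym (map-∘ (copiesAt c b e)))))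
        (Σᴸ-filter (λ i → incident c b i e) (λ i → f (copy i (term b))))

  module _ {c c′ : Wiring N M} (T : Transplantation c c′) where

    open Transplantation T
    open IsLinear

    private
      module A = Wired H 0<H even c
      module B = Wired H 0<H even c′
      open A using (Node)

    -- `A` mixes the copies at a fixed position `p` and never moves along the path. Its interplay
    -- with adjacency is therefore trivial inside the copies and reduces to the incidence matrices
    -- at the two ends.
    blockMap : Matrixℚ N N → Matrixℚ M M → (Node → ℝ) → Node → ℝ
    blockMap A B f (copy i p) = apply A (λ j → f (copy j p)) i
    blockMap A B f (mid e)    = apply B (f ∘ mid) e

    blockMap-linear : ∀ A B → IsLinear (blockMap A B)
    blockMap-linear A B = record
      { φ-cong = λ { f≃g (copy i p) → φ-cong (apply-linear A) (λ j → f≃g (copy j p)) i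
                   ; f≃g (mid e) → φ-cong (apply-linear B) (f≃g ∘ mid) e }
      ; φ-+ = λ { f g (copy i p) → φ-+ (apply-linear A) (λ j → f (copy j p)) (λ j → g (copy j p)) i
                ; f g (mid e) → φ-+ (apply-linear B) (f ∘ mid) (g ∘ mid) e }
      ; φ-* = λ { k f (copy i p) → φ-* (apply-linear A) k (λ j → f (copy j p)) i
                ; k f (mid e) → φ-* (apply-linear B) k (f ∘ mid) e }
      }

    blockMap-inverse : ∀ {A A′ B B′} → A ⊗ A′ ≗ᵐ identity → B ⊗ B′ ≗ᵐ identity →
      ∀ f v → blockMap A B (blockMap A′ B′ f) v ≃ f v
    blockMap-inverse {A} {A′} eq eq′ f (copy i p) =
      ≃-trans (apply-⊗ A A′ (λ j → f (copy j p)) i)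
        (≃-trans (apply-≗ eq (λ j → f (copy j p)) i) (apply-identity (λ j → f (copy j p)) i))
    blockMap-inverse {B = B} {B′} eq eq′ f (mid e) =
      ≃-trans (apply-⊗ B B′ (f ∘ mid) e) (≃-trans (apply-≗ eq′ (f ∘ mid) e) (apply-identity (f ∘ mid) e))

    blockMap-intertwines : ∀ f v → blockMap P R (λ u → Σᴸ (map f (A.wiredNbrs u))) v
      ≃ Σᴸ (map (blockMap P R f) (B.wiredNbrs v))
    blockMap-intertwines f (copy i p) = begin
      apply P (λ j → Σᴸ (map f (A.wiredNbrs (copy j p)))) i
        ≈⟨ φ-cong lin (λ j → operator-copy c f j p) i ⟩
      apply P (λ j → path j +ℝ (midPart c false f j p +ℝ midPart c true f j p)) i
        ≈⟨ ≃-trans (φ-+ lin path _ i)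
             (+-cong ≃-refl (φ-+ lin (λ j → midPart c false f j p) (λ j → midPart c true f j p) i)) ⟩
      apply P path i +ℝ (apply P (λ j → midPart c false f j p) i +ℝ apply P (λ j → midPart c true f j p) i)
        ≈⟨ +-cong (φ-Σᴸ lin (λ q j → f (copy j q)) (along-nbrs p) i) (+-cong (mid-part false) (mid-part true)) ⟩
      Σᴸ (map (λ q → blockMap P R f (copy i q)) (along-nbrs p)) +ℝ
        (midPart c′ false (blockMap P R f) i p +ℝ midPart c′ true (blockMap P R f) i p)
        ≈⟨ ≃-sym (operator-copy c′ (blockMap P R f) i p) ⟩
      Σᴸ (map (blockMap P R f) (B.wiredNbrs (copy i p))) ∎
      where
      lin : IsLinear (apply P)
      lin = apply-linear P

      path : Fin N → ℝ
      path j = Σᴸ (map (λ q → f (copy j q)) (along-nbrs p))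

      mid-part : ∀ b → apply P (λ j → midPart c b f j p) i ≃ midPart c′ b (blockMap P R f) i p
      mid-part b with does (p Finₚ.≟ term b)
      ... | false = φ-0 lin i
      ... | true  = apply-intertwine P (incidence c b) (incidence c′ b) R (copies b) (f ∘ mid) i
    blockMap-intertwines f (mid e) = begin
      apply R (λ e → Σᴸ (map f (A.wiredNbrs (mid e)))) e
        ≈⟨ φ-cong lin (operator-mid c f) e ⟩
      apply R (λ e → end false e +ℝ end true e) e
        ≈⟨ φ-+ lin (end false) (end true) e ⟩
      apply R (end false) e +ℝ apply R (end true) e
        ≈⟨ +-cong (end-part false) (end-part true) ⟩
      _ ≈⟨ ≃-sym (operator-mid c′ (blockMap P R f) e) ⟩
      Σᴸ (map (blockMap P R f) (B.wiredNbrs (mid e))) ∎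
      where
      lin : IsLinear (apply R)
      lin = apply-linear R

      end : Bool → Fin M → ℝ
      end b = apply (transposed (incidence c b)) (λ i → f (copy i (term b)))

      end-part : ∀ b → apply R (end b) e ≃
        apply (transposed (incidence c′ b)) (λ i → blockMap P R f (copy i (term b))) e
      end-part b = apply-intertwine R (transposed (incidence c b))
        (transposed (incidence c′ b)) P (mids b) (λ i → f (copy i (term b))) e

    transplant-~ : ∀ {proper proper′} → A.wired proper ~ B.wired proper′
    transplant-~ = record
      { to = blockMap P R ; from = blockMap P⁻¹ R⁻¹
      ; to-linear = blockMap-linear P R ; from-linear = blockMap-linear P⁻¹ R⁻¹
      ; to-from = blockMap-inverse PP⁻¹ RR⁻¹ ; from-to = blockMap-inverse P⁻¹P R⁻¹R
      ; intertwines = blockMap-intertwines }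

-- Equal degrees in two wirings

module Rebalance (H : ℕ) (0<H : 0 < H) (even : parity H ≡ false) {N M : ℕ} where

  module _ {c c′ : Wiring N M} (π : Bool → Fin N → Fin N) (involutive : ∀ b i → π b (π b i) ≡ i)
    (balanced : ∀ b i → length (midsAt c′ b (π b i)) ≡ length (midsAt c b i)) where

    private
      module A = Wired H 0<H even c
      module B = Wired H 0<H even c′

      end? : Fin (suc H) → Bool
      end? p = not (does (p Finₚ.≟ term false))

      -- The two ends of a copy may go to different copies, as a degree matching ignores adjacency.
      -- Interior positions move with `π true`; the degree there is the same in every copy.
      permute : A.Node → A.Node
      permute (copy i p) = copy (π (end? p) i) p
      permute (mid e)    = mid e

      permute-involutive : ∀ v → permute (permute v) ≡ v
      permute-involutive (copy i p) = cong (λ j → copy j p) (involutive (end? p) i)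
      permute-involutive (mid e)    = refl

      port-balanced : ∀ b i p → length (B.portMids b (π (end? p) i) p) ≡ length (A.portMids b i p)
      port-balanced false i p with p Finₚ.≟ term false
      ... | yes _ = balanced false i
      ... | no  _ = refl
      port-balanced true i p with p Finₚ.≟ term true
      ... | no  _ = refl
      ... | yes eq with p Finₚ.≟ term false
      ...   | yes eq′ = contradiction (trans (sym eq′) eq) (A.term-≢ false)
      ...   | no  _   = balanced true i

    permute-match : ∀ {proper proper′} → DegreeMatching (A.wired proper) (B.wired proper′)
    permute-match {proper} {proper′} = record
      { match = record { to = permute ; from = permute ; to-cong = cong permute ; from-cong = cong permute
                       ; inverse = (λ { refl → permute-involutive _ }) , (λ { refl → permute-involutive _ }) }
      ; match-colour = λ { (copy i p) → refl ; (mid e) → refl }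
      ; match-degree = λ { (copy i p) → trans (B.wired-degree (π (end? p) i) p) (trans
                             (cong (λ n → (length (toward false p) + length (toward true p)) + n)
                               (cong₂ _+_ (port-balanced false i p) (port-balanced true i p)))
                             (sym (A.wired-degree i p)))
                         ; (mid e) → trans (B.wired-binary proper′ (mid e) refl)
                                   (sym (A.wired-binary proper (mid e) refl)) }
      }

-- Wired graphs pruned down to a single cycle or to nothing

two-slots : ∀ {A : Set} → A → (xs : List A) → length xs ≤ 2 → ∃₂ λ x y → ∀ {u} → u ∈ xs → u ≡ x ⊎ u ≡ y
two-slots z []               _ = z , z , λ ()
two-slots z (x ∷ [])         _ = x , x , λ { (here eq) → inj₁ eq }
two-slots z (x ∷ y ∷ [])     _ = x , y , λ { (here eq) → inj₁ eq ; (there (here eq)) → inj₂ eq }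
two-slots z (_ ∷ _ ∷ _ ∷ _) (s≤s (s≤s ()))

firstOr : ∀ {A : Set} → A → List A → A
firstOr z []      = z
firstOr z (x ∷ _) = x

first-below : ∀ {A B : Set} {n} (f : Fin (suc n) → A) (g : A → B) p {x z} →
  x ∈ map f (below p) → g x ≡ firstOr z (map g (map f (below p)))
first-below {n = suc n} f g (suc p) (here refl) = refl

module Hung (H : ℕ) (0<H : 0 < H) (even : parity H ≡ false) {N M : ℕ} (c : Wiring N M) (proper : Proper c) where

  open Wired H 0<H even c

  -- A copy that carries no cycle is pruned towards its end b, which has rank K
  -- and hangs from x.
  data Kind : Set where
    core : Kind
    hung : (b : Bool) (K : ℕ) (x : Node) → Kind

  copyRank : Kind → Fin (suc H) → ℕ
  copyRank core         p = 0
  copyRank (hung b K x) p = K + dist b p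

  -- This leaves a vertex of rank 0 with at most two neighbours of rank 0.
  Slim : Kind → Fin N → Set
  Slim core               i = ∀ b → length (midsAt c b i) ≤ 1
  Slim (hung b zero x)    i = length (midsAt c b i) ≤ 2
  Slim (hung b (suc K) x) i = ⊤

  module _ (kind : Fin N → Kind) (midRank : Fin M → ℕ) (midParent : Fin M → Node) where

    nodeRank : Node → ℕ
    nodeRank (copy i p) = copyRank (kind i) p
    nodeRank (mid e)    = midRank e

    -- At the end `b` nothing is nearer to `b`, and the default `x` of `firstOr` steps in: the
    -- vertex from which the copy hangs. A core copy has rank 0 and is never pruned, so its own
    -- vertex is a placeholder.
    copyParent : Kind → Fin N → Fin (suc H) → Node
    copyParent core         i p = copy i p
    copyParent (hung b K x) i p = firstOr x (map (copy i) (toward b p))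

    nodeParent : Node → Node
    nodeParent (copy i p) = copyParent (kind i) i p
    nodeParent (mid e)    = midParent e

    -- A hung copy has rank `K` at the end `b` and `K + H` at the other. A new vertex at the far end
    -- must have rank beyond `K + H`. One at `b` may also be the parent `x`, and for `K ≡ 0` the end
    -- is not pruned at all.
    MidBeyond : Kind → Fin M → Bool → Set
    MidBeyond core         e b′ = ⊤
    MidBeyond (hung b K x) e b′ =
      (b′ ≡ b × (mid e ≡ x ⊎ K ≡ 0 ⊎ K < midRank e)) ⊎ (b′ ≡ not b × K + H < midRank e)

    TermBeyond : Fin M → Bool × Fin N → Set
    TermBeyond e (b , i) = 0 < midRank e → copy i (term b) ≡ midParent e ⊎ midRank e < copyRank (kind i) (term b)

    -- Where e meets an end of the copy i, each of the two vertices is the parent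
    -- of the other one or has a larger rank.
    Hangs : Fin M → Bool × Fin N → Set
    Hangs e (b , i) = MidBeyond (kind i) e b × TermBeyond e (b , i)

    Hanging : Set
    Hanging = ∀ e → Hangs e (proj₁ (c e)) × Hangs e (proj₂ (c e))

    module _ (hangs : Hanging) where

      private
        hangs-at : ∀ {b i e} → T (incident c b i e) → Hangs e (b , i)
        hangs-at {b} {i} {e} t = Sum.[ (λ eq → subst (Hangs e) (sym eq) (proj₁ (hangs e)))
                                     , (λ eq → subst (Hangs e) (sym eq) (proj₂ (hangs e))) ]′
                                       (incident⁻ c {b} {i} {e} t)

        first-toward : ∀ b {p q : Fin (suc H)} {i : Fin N} (x : Node) → q ∈ toward b p →
          copy i q ≡ firstOr x (map (copy i) (toward b p))
        first-toward b {p} {i = i} x q∈ = first-below (flip b) (copy i) (flip b p) q∈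

        toward-term : ∀ b → toward {H} b (term {H} b) ≡ []
        toward-term b = cong (λ p → map (flip b) (below p)) (flip-involutive b zero)

      pruned : ∀ {u v} → Joined u v → 0 < nodeRank v → nodeRank u ≤ nodeRank v → u ≡ nodeParent v
      pruned (along b′ {i} {p} {q} eq) 0<v u≤v with kind i
      ... | core with () ← 0<v
      ... | hung b K x with dist-<-not b b′ {p} {q} eq
      ...   | inj₁ refl = first-toward b {p} {q} x (∈-toward⁺ b {p} {q} eq)
      -- A neighbour farther from `b` has larger rank, against `u≤v`.
      ...   | inj₂ eq′  = contradiction (ℕₚ.+-cancelˡ-≤ K _ _ u≤v) (ℕₚ.<⇒≱ (ℕₚ.≤-reflexive (sym eq′)))
      pruned (out b′ {i} {e} t) 0<v u≤v with kind i | proj₁ (hangs-at {b′} {i} {e} t)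
      ... | core       | _ with () ← 0<v
      ... | hung b K x | inj₁ (refl , choice) = root choice
        where
        rank≡ : K + dist {H} b (term b) ≡ K
        rank≡ = trans (cong (K +_) (dist-term {H} b)) (ℕₚ.+-identityʳ K)

        root : mid e ≡ x ⊎ K ≡ 0 ⊎ K < midRank e → mid e ≡ firstOr x (map (copy i) (toward b (term b)))
        root (inj₁ eq)         = trans eq (cong (λ ps → firstOr x (map (copy i) ps)) (sym (toward-term b)))
        root (inj₂ (inj₁ K≡0)) = contradiction (trans rank≡ K≡0) (λ eq → ℕₚ.<⇒≢ 0<v (sym eq))
        root (inj₂ (inj₂ K<))  = contradiction (subst (midRank e ≤_) rank≡ u≤v) (ℕₚ.<⇒≱ K<)
      ... | hung b K x | inj₂ (refl , K+H<) =
        contradiction (subst (λ d → midRank e ≤ K + d) (dist-not-term b) u≤v) (ℕₚ.<⇒≱ K+H<)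
      pruned (into b {i} {e} t) 0<v u≤v =
        Sum.[ id , (λ v<u → contradiction u≤v (ℕₚ.<⇒≱ v<u)) ]′ (proj₂ (hangs-at {b} {i} {e} t) 0<v)

      pruning : Pruning (wired proper)
      pruning = record { rank = nodeRank ; parent = nodeParent ; prune = λ {u} {v} u∈ → pruned (joined⁻ v u∈) }

      module _ (slim : ∀ i → Slim (kind i) i) where

        private
          -- On the side facing `b`, a vertex has either one path neighbour or, if it is the end
          -- itself, the new vertices there, but never both.
          end-length : ∀ b i p → length (midsAt c b i) ≤ 1 → length (toward b p) + length (portMids b i p) ≤ 1
          end-length b i p ≤1 = subst (λ n → n + length (portMids b i p) ≤ 1) (sym (toward-length b p))
            (go (does (p Finₚ.≟ term b)))
            where
            go : ∀ t → (if t then 0 else 1) + length (if t then midsAt c b i else []) ≤ 1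
            go true  = ≤1
            go false = ℕₚ.≤-refl

          core-degree : ∀ i p → (∀ b → length (midsAt c b i) ≤ 1) → length (wiredNbrs (copy i p)) ≤ 2
          core-degree i p ≤1 = ℕₚ.≤-trans (ℕₚ.≤-reflexive (trans (wired-degree i p)
              (interchange (length (toward false p)) (length (toward true p))
                (length (portMids false i p)) (length (portMids true i p)))))
            (ℕₚ.+-mono-≤ (end-length false i p (≤1 false)) (end-length true i p (≤1 true)))
            where
            interchange : ∀ a b c d → (a + b) + (c + d) ≡ (a + c) + (b + d)
            interchange = solve-∀

          -- The path neighbours of such an end have rank 1, and the new vertices at the opposite
          -- end are not adjacent to it because the two ends differ. What is left are the new
          -- vertices at the end `b`.
          root-mids : ∀ b {i K x u p} → kind i ≡ hung b K x → K ≡ 0 → p ≡ term b →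
            Joined u (copy i p) → nodeRank u ≡ 0 → u ∈ map mid (midsAt c b i)
          root-mids b {i} {K} {x} kind≡ refl p≡ (along b′ {p = p} {q} eq) rank≡ =
            ⊥-elim (ℕₚ.m≢1+n+m (dist b′ q) {0} (trans (cong (dist b′) (trans q≡ (sym p≡))) eq))
            where
            q≡ : q ≡ term b
            q≡ = dist-0 b (trans (cong (λ k → copyRank k q) (sym kind≡)) rank≡)
          root-mids b kind≡ K≡ p≡ (out b′ {i} {e} t) rank≡ with b ≟ᵇ b′
          ... | yes refl = ∈-map⁺ mid (∈-filter⁺ (T? ∘ incident c b i) (∈-allFin e) t)
          ... | no b≢b′  = ⊥-elim (term-≢ b (trans (sym p≡) (cong term (¬-not (b≢b′ ∘ sym)))))

        two-core : ∀ v → nodeRank v ≡ 0 → ∃₂ λ x y → ∀ {u} → u ∈ wiredNbrs v → nodeRank u ≡ 0 → u ≡ x ⊎ u ≡ y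
        two-core (mid e) _ =
          let x , y , two = two-slots (mid e) _ (ℕₚ.≤-reflexive (wired-binary proper (mid e) refl)) in
          x , y , λ u∈ _ → two u∈
        two-core (copy i p) rank≡ with kind i in kind≡ | slim i
        ... | core | ≤1 = let x , y , two = two-slots (copy i p) _ (core-degree i p ≤1) in x , y , λ u∈ _ → two u∈
        ... | hung b zero x | ≤2 =
          let x , y , two = two-slots (copy i p) (map mid (midsAt c b i))
                    (ℕₚ.≤-trans (ℕₚ.≤-reflexive (length-map mid (midsAt c b i))) ≤2) in
          x , y , λ u∈ rank≡′ → two (root-mids b kind≡ refl (dist-0 b rank≡) (joined⁻ (copy i p) u∈) rank≡′)

  -- Necklaces

  -- `run b i` traverses a whole copy, starting at its end `b`. A `single` is a new vertex, or an
  -- end of a copy which the cycle merely touches.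
  data Block : Set where
    run    : Bool → Fin N → Block
    single : Node → Block

  first last : Block → Node
  first (run b i)  = copy i (term b)
  first (single v) = v
  last (run b i)  = copy i (flip b (fromℕ H))
  last (single v) = v

  blockPoints : Block → List Node
  blockPoints (run b i)  = map (λ p → copy i (flip b p)) (allFin (suc H))
  blockPoints (single v) = v ∷ []

  blockSize : Block → ℕ
  blockSize (run b i)  = suc H
  blockSize (single v) = 1

  -- Blocks with different tags have disjoint points. Distinctness along a necklace, whose length
  -- depends on `H`, thus reduces to distinctness in a short concrete list, which evaluation
  -- decides.
  tag : Node → Fin N ⊎ Fin M
  tag (copy i p) = inj₁ i
  tag (mid e)    = inj₂ e

  blockTag : Block → Fin N ⊎ Fin M
  blockTag (run b i)  = inj₁ i
  blockTag (single v) = tag v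

  private
    climb : ∀ n → Trail (λ p q → toℕ q ≡ suc (toℕ p)) (zero {n}) (fromℕ n)
    climb zero    = [ zero ]
    climb (suc n) = _∷_ {y = suc zero} refl (mapTrail suc (cong suc) (climb n))

    climb-points : ∀ n → points (climb n) ≡ allFin (suc n)
    climb-points zero    = refl
    climb-points (suc n) = cong (zero ∷_) (trans (points-mapTrail suc (cong suc) (climb n))
      (trans (cong (map suc) (climb-points n)) (map-tabulate id suc)))

    climb-arc : ∀ b i {p q : Fin (suc H)} → toℕ q ≡ suc (toℕ p) →
      Arc (wired proper) (copy i (flip b p)) (copy i (flip b q))
    climb-arc b i {p} {q} eq = joined⁺ (joined-sym (along b {p = flip b q} {flip b p}
      (trans (cong toℕ (flip-involutive b q)) (trans eq (cong (suc ∘ toℕ) (sym (flip-involutive b p)))))))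

  blockTrail : ∀ B → Trail (Arc (wired proper)) (first B) (last B)
  blockTrail (run b i)  = mapTrail (λ p → copy i (flip b p)) (λ {p} {q} → climb-arc b i {p} {q}) (climb H)
  blockTrail (single v) = [ v ]

  blockTrail-points : ∀ B → points (blockTrail B) ≡ blockPoints B
  blockTrail-points (run b i)  = trans (points-mapTrail (λ p → copy i (flip b p)) (λ {p} {q} → climb-arc b i {p} {q})
    (climb H))
    (cong (map (λ p → copy i (flip b p))) (climb-points H))
  blockTrail-points (single v) = refl

  block-unique : ∀ B → Unique (blockPoints B)
  block-unique (run b i)  = Unique.map⁺ (flip-injective b ∘ copy-injective) (Unique.allFin⁺ (suc H))
  block-unique (single v) = [] ∷ []

  block-tag : ∀ B {v} → v ∈ blockPoints B → tag v ≡ blockTag B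
  block-tag (run b i) v∈ with _ , _ , refl ← ∈-map⁻ (λ p → copy i (flip b p)) v∈ = refl
  block-tag (single v) (here refl) = refl

  block-length : ∀ B → length (blockPoints B) ≡ blockSize B
  block-length (run b i)  = trans (length-map (λ p → copy i (flip b p)) (allFin (suc H))) (length-tabulate id)
  block-length (single v) = refl

  ∈-run : ∀ b i p → copy i p ∈ blockPoints (run b i)
  ∈-run b i p = subst (λ q → copy i q ∈ blockPoints (run b i)) (flip-involutive b p)
    (∈-map⁺ (λ p → copy i (flip b p)) (∈-allFin (flip b p)))

  leave : ∀ b i e → T (incident c (not b) i e) → Arc (wired proper) (last (run b i)) (mid e)
  leave b i e t = joined⁺ (subst (λ p → Joined (mid _) (copy i p)) (sym (flip-last b)) (out (not b) t))

  enter : ∀ b i e → T (incident c b i e) → Arc (wired proper) (mid e) (copy i (term b))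
  enter b i e t = joined⁺ (into b t)

  exit : ∀ b i e → T (incident c b i e) → Arc (wired proper) (copy i (term b)) (mid e)
  exit b i e t = joined⁺ (out b t)

  infixr 5 _∷_

  data Chained : Block → List Block → Block → Set where
    [_] : ∀ B → Chained B [] B
    _∷_ : ∀ {B C Cs Z} → Arc (wired proper) (last B) (first C) → Chained C Cs Z → Chained B (C ∷ Cs) Z

  chainTrail : ∀ {B Bs Z} → Chained B Bs Z → Trail (Arc (wired proper)) (first B) (last Z)
  chainTrail [ B ]           = blockTrail B
  chainTrail (_∷_ {B} r ch)  = blockTrail B ▷⟨ r ⟩ chainTrail ch

  chain-points : ∀ {B Bs Z} (ch : Chained B Bs Z) → points (chainTrail ch) ≡ concat (map blockPoints (B ∷ Bs))
  chain-points [ B ]          = trans (blockTrail-points B) (sym (++-identityʳ _))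
  chain-points (_∷_ {B} r ch) = trans (points-▷ (blockTrail B)) (cong₂ _++_ (blockTrail-points B) (chain-points ch))

  blocks-unique : ∀ Bs → Unique (map blockTag Bs) → Unique (concat (map blockPoints Bs))
  blocks-unique Bs uniq = Unique.concat⁺ (Allₚ.map⁺ (All.universal block-unique Bs))
    (AllPairsₚ.map⁺ (AllPairs.map (λ {B} {C} B≢C {v} (v∈ : v ∈ blockPoints B × v ∈ blockPoints C) →
        B≢C (trans (sym (block-tag B (proj₁ v∈))) (block-tag C (proj₂ v∈))))
      (AllPairsₚ.map⁻ uniq)))

  blocks-length : ∀ Bs → length (concat (map blockPoints Bs)) ≡ sum (map blockSize Bs)
  blocks-length []       = refl
  blocks-length (B ∷ Bs) = trans (length-++ (blockPoints B)) (cong₂ _+_ (block-length B) (blocks-length Bs))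

  module _ {B Bs Z ℓ} (ch : Chained B Bs Z) (closing : Arc (wired proper) (last Z) (first B))
    (uniq : Unique (map blockTag (B ∷ Bs))) (size≡ : sum (map blockSize (B ∷ Bs)) ≡ ℓ) (3≤ℓ : 3 ≤ ℓ) where

    private
      points-unique : Unique (points (chainTrail ch))
      points-unique = subst Unique (sym (chain-points ch)) (blocks-unique (B ∷ Bs) uniq)

      points-length : length (points (chainTrail ch)) ≡ ℓ
      points-length = trans (cong length (chain-points ch)) (trans (blocks-length (B ∷ Bs)) size≡)

    necklace : Circuit (wired proper) ℓ
    necklace = closeTrail {wired proper} (chainTrail ch) closing points-unique points-length 3≤ℓ

    necklace-cover : ∀ {C v} → C ∈ B ∷ Bs → v ∈ blockPoints C → ∃ λ i → at necklace i ≡ v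
    necklace-cover C∈ v∈ = closeTrail-cover {wired proper} (chainTrail ch) closing points-unique points-length 3≤ℓ
      (subst (_ ∈_) (sym (chain-points ch)) (∈-concat⁺′ v∈ (∈-map⁺ blockPoints C∈)))

    necklace-count : ∀ {kind midRank midParent} → Hanging kind midRank midParent →
      (∀ i → Slim (kind i) i) →
      (∀ v → nodeRank kind midRank midParent v ≡ 0 → ∃ λ C → C ∈ B ∷ Bs × v ∈ blockPoints C) →
      ∀ n → CircuitCount (wired proper) n (if does (n ℕₚ.≟ ℓ) then 1 else 0)
    necklace-count {kind} {midRank} {midParent} hangs slim cover =
      Pruning.unicyclic-count (pruning kind midRank midParent hangs)
        (two-core kind midRank midParent hangs slim) necklace
        λ v rank≡ → let C , C∈ , v∈ = cover v rank≡ in necklace-cover C∈ v∈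

-- The wirings

star triangle : Wiring 4 3

star 0F = (false , 0F) , (false , 1F)
star 1F = (false , 0F) , (false , 2F)
star 2F = (true , 0F) , (true , 3F)

triangle 0F = (false , 0F) , (false , 1F)
triangle 1F = (false , 1F) , (false , 2F)
triangle 2F = (true , 0F) , (true , 2F)

square digon : Wiring 6 4

square 0F = (false , 0F) , (false , 1F)
square 1F = (false , 2F) , (false , 3F)
square 2F = (true , 1F) , (true , 2F)
square 3F = (true , 3F) , (true , 0F)

digon 0F = (false , 0F) , (false , 1F)
digon 1F = (false , 2F) , (false , 3F)
digon 2F = (true , 0F) , (true , 1F)
digon 3F = (true , 4F) , (true , 5F)

proper? : ∀ {N M} (c : Wiring N M) → Dec (Proper c)
proper? c = Finₚ.all? λ e → _ ℕₚ.≟ 2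

infix 4 _≗ᵐ?_

-- Rational entries make matrix identities decidable, so the identities of a transplantation are
-- settled by evaluation although the matrices act on real vectors.
_≗ᵐ?_ : ∀ {m n} (A B : Matrixℚ m n) → Dec (A ≗ᵐ B)
A ≗ᵐ? B = Finₚ.all? λ i → Finₚ.all? λ j → A i j ℚₚ.≟ B i j

fractions : ∀ {m n} (d : ℕ) .{{_ : NonZero d}} → Vec (Vec ℤ n) m → Matrixℚ m n
fractions d rows i j = Vec.lookup (Vec.lookup rows i) j ℚ./ d

-- The star with three edges and the triangle have the same line graph: in both, any two of the
-- three new vertices share exactly one copy. The incidence vectors of the new vertices thus have
-- the same Gram matrix, and an orthogonal `P` carries one triple to the other with `R` the
-- identity. It sends half of (1, -1, -1, -1), perpendicular to the first triple, to the isolated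
-- copy. With `P` orthogonal, `mids` is the transpose of `copies`.
star-triangle : Transplantation star triangle
star-triangle = record
  { P = P ; P⁻¹ = transposed P ; R = identity ; R⁻¹ = identity
  ; PP⁻¹ = from-yes (P ⊗ transposed P ≗ᵐ? identity)
  ; P⁻¹P = from-yes (transposed P ⊗ P ≗ᵐ? identity)
  ; RR⁻¹ = from-yes (identity ⊗ identity ≗ᵐ? identity {3})
  ; R⁻¹R = from-yes (identity ⊗ identity ≗ᵐ? identity {3})
  ; copies = λ { false → from-yes (P ⊗ incidence star false ≗ᵐ? incidence triangle false ⊗ identity)
               ; true → from-yes (P ⊗ incidence star true ≗ᵐ? incidence triangle true ⊗ identity) }
  ; mids = λ { false → from-yes (identity ⊗ transposed (incidence star false)
                                   ≗ᵐ? transposed (incidence triangle false) ⊗ P)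
             ; true → from-yes (identity ⊗ transposed (incidence star true)
                                  ≗ᵐ? transposed (incidence triangle true) ⊗ P) }
  }
  where
  open Integer using (+_; -_)

  P : Matrixℚ 4 4
  P = fractions 2
    ( (+ 1 ∷ + 1 ∷ - + 1 ∷ + 1 ∷ [])
    ∷ (+ 1 ∷ + 1 ∷ + 1 ∷ - + 1 ∷ [])
    ∷ (+ 1 ∷ - + 1 ∷ + 1 ∷ + 1 ∷ [])
    ∷ (+ 1 ∷ - + 1 ∷ - + 1 ∷ - + 1 ∷ [])
    ∷ [])

-- `R` takes sums and differences of the two new vertices at either kind of end of the digon wiring.
-- The incidence vectors so combined have exactly twice the inner products of those of the square.
-- Hence `P` and `R` are orthogonal matrices times the square root of 2; this scaling keeps the
-- entries rational and makes each inverse half the transpose.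
square-digon : Transplantation square digon
square-digon = record
  { P = P ; P⁻¹ = P⁻¹ ; R = R ; R⁻¹ = R⁻¹
  ; PP⁻¹ = from-yes (P ⊗ P⁻¹ ≗ᵐ? identity)
  ; P⁻¹P = from-yes (P⁻¹ ⊗ P ≗ᵐ? identity)
  ; RR⁻¹ = from-yes (R ⊗ R⁻¹ ≗ᵐ? identity)
  ; R⁻¹R = from-yes (R⁻¹ ⊗ R ≗ᵐ? identity)
  ; copies = λ { false → from-yes (P ⊗ incidence square false ≗ᵐ? incidence digon false ⊗ R)
               ; true → from-yes (P ⊗ incidence square true ≗ᵐ? incidence digon true ⊗ R) }
  ; mids = λ { false → from-yes (R ⊗ transposed (incidence square false) ≗ᵐ? transposed (incidence digon false) ⊗ P)
             ; true → from-yes (R ⊗ transposed (incidence square true) ≗ᵐ? transposed (incidence digon true) ⊗ P) }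
  }
  where
  open Integer using (+_; -_)

  P P⁻¹ : Matrixℚ 6 6
  P = fractions 2
    ( (+ 1 ∷ + 1 ∷ + 1 ∷ + 1 ∷ + 2 ∷ + 0 ∷ [])
    ∷ (+ 1 ∷ + 1 ∷ + 1 ∷ + 1 ∷ - + 2 ∷ + 0 ∷ [])
    ∷ (+ 1 ∷ + 1 ∷ - + 1 ∷ - + 1 ∷ + 0 ∷ + 2 ∷ [])
    ∷ (+ 1 ∷ + 1 ∷ - + 1 ∷ - + 1 ∷ + 0 ∷ - + 2 ∷ [])
    ∷ (+ 2 ∷ - + 2 ∷ + 0 ∷ + 0 ∷ + 0 ∷ + 0 ∷ [])
    ∷ (+ 0 ∷ + 0 ∷ - + 2 ∷ + 2 ∷ + 0 ∷ + 0 ∷ [])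
    ∷ [])
  P⁻¹ = fractions 4
    ( (+ 1 ∷ + 1 ∷ + 1 ∷ + 1 ∷ + 2 ∷ + 0 ∷ [])
    ∷ (+ 1 ∷ + 1 ∷ + 1 ∷ + 1 ∷ - + 2 ∷ + 0 ∷ [])
    ∷ (+ 1 ∷ + 1 ∷ - + 1 ∷ - + 1 ∷ + 0 ∷ - + 2 ∷ [])
    ∷ (+ 1 ∷ + 1 ∷ - + 1 ∷ - + 1 ∷ + 0 ∷ + 2 ∷ [])
    ∷ (+ 2 ∷ - + 2 ∷ + 0 ∷ + 0 ∷ + 0 ∷ + 0 ∷ [])
    ∷ (+ 0 ∷ + 0 ∷ + 2 ∷ - + 2 ∷ + 0 ∷ + 0 ∷ [])
    ∷ [])

  R R⁻¹ : Matrixℚ 4 4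
  R = fractions 1
    ( (+ 1 ∷ + 1 ∷ + 0 ∷ + 0 ∷ [])
    ∷ (+ 1 ∷ - + 1 ∷ + 0 ∷ + 0 ∷ [])
    ∷ (+ 0 ∷ + 0 ∷ + 1 ∷ + 1 ∷ [])
    ∷ (+ 0 ∷ + 0 ∷ - + 1 ∷ + 1 ∷ [])
    ∷ [])
  R⁻¹ = fractions 2
    ( (+ 1 ∷ + 1 ∷ + 0 ∷ + 0 ∷ [])
    ∷ (+ 1 ∷ - + 1 ∷ + 0 ∷ + 0 ∷ [])
    ∷ (+ 0 ∷ + 0 ∷ + 1 ∷ - + 1 ∷ [])
    ∷ (+ 0 ∷ + 0 ∷ + 1 ∷ + 1 ∷ [])
    ∷ [])

-- A cycle alone would be bi-regular; the second copy stays free, and its ends of degree 1 prevent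
-- this.
loop : Wiring 2 1
loop 0F = (false , 0F) , (true , 0F)

loop-proper : Proper loop
loop-proper = from-yes (proper? loop)

star-proper : Proper star
star-proper = from-yes (proper? star)

triangle-proper : Proper triangle
triangle-proper = from-yes (proper? triangle)

square-proper : Proper square
square-proper = from-yes (proper? square)

digon-proper : Proper digon
digon-proper = from-yes (proper? digon)

swap : ∀ {n} → Fin n → Fin n → Fin n → Fin n
swap i j k = if does (k Finₚ.≟ i) then j else if does (k Finₚ.≟ j) then i else k

unique-tags? : ∀ {N M} (ts : List (Fin N ⊎ Fin M)) → Dec (Unique ts)
unique-tags? = DecUnique.unique? (⊎-≡-dec Finₚ._≟_ Finₚ._≟_)

exactly : ℕ → ℕ → ℕ
exactly m ℓ = if does (ℓ ℕₚ.≟ m) then 1 else 0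

-- Cycle numbers, similarities and degree matchings of the concrete wirings

module Shapes (H : ℕ) (0<H : 0 < H) (even : parity H ≡ false) where

  module Loop     = Hung H 0<H even loop loop-proper
  module Star     = Hung H 0<H even star star-proper
  module Triangle = Hung H 0<H even triangle triangle-proper
  module Square   = Hung H 0<H even square square-proper
  module Digon    = Hung H 0<H even digon digon-proper

  graph-of : ∀ {N M} (c : Wiring N M) → Proper c → Bigraph
  graph-of c = Wired.wired H 0<H even c

  loop-count : ∀ ℓ → CircuitCount (graph-of loop loop-proper) ℓ (exactly (H + 2) ℓ)
  -- The trailing underscores in the arcs stand for incidences, which evaluate to the unit type.
  loop-count = necklace-count (leave false 0F 0F _ ∷ [ _ ]) (enter false 0F 0F _)
      (from-yes (unique-tags? (map blockTag (run false 0F ∷ single (mid 0F) ∷ []))))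
      (lengths H) (ℕₚ.+-monoˡ-≤ 2 0<H) hangs slim cover
    where
    open Loop

    kind : Fin 2 → Kind
    kind 0F = core
    -- Starting at rank 1 keeps the free copy out of the core. No new vertex meets its root, so
    -- `mid 0F` is a placeholder for the parent.
    kind 1F = hung false 1 (mid 0F)

    hangs : Hanging kind (λ _ → 0) mid
    hangs 0F = (tt , λ ()) , (tt , λ ())

    slim : ∀ i → Slim (kind i) i
    slim 0F = λ { false → s≤s z≤n ; true → s≤s z≤n }
    slim 1F = tt

    lengths : ∀ H → suc H + (1 + 0) ≡ H + 2
    lengths = solve-∀

    cover : ∀ v → nodeRank kind (λ _ → 0) mid v ≡ 0 →
      ∃ λ C → C ∈ run false 0F ∷ single (mid 0F) ∷ [] × v ∈ blockPoints C
    cover (copy 0F p) _ = _ , here refl , ∈-run false 0F p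
    cover (copy 1F p) ()
    cover (mid 0F)    _ = _ , there (here refl) , here refl

  triangle-count : ∀ ℓ → CircuitCount (graph-of triangle triangle-proper) ℓ (exactly (2 * (H + 3)) ℓ)
  triangle-count = necklace-count
      (leave false 0F 2F _ ∷ enter true 2F 2F _ ∷ leave true 2F 1F _ ∷
       enter false 1F 1F _ ∷ exit false 1F 0F _ ∷ [ _ ])
      (enter false 0F 0F _)
      (from-yes (unique-tags? (map blockTag blocks)))
      (lengths H) (ℕₚ.≤-trans (ℕₚ.m≤n+m 3 H) (ℕₚ.m≤m+n (H + 3) _)) hangs slim cover
    where
    open Triangle

    blocks : List Block
    blocks = run false 0F ∷ single (mid 2F) ∷ run true 2F ∷ single (mid 1F) ∷
             single (copy 1F (term false)) ∷ single (mid 0F) ∷ []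

    kind : Fin 4 → Kind
    kind 0F = core
    -- The cycle passes from `mid 1F` to `mid 0F` through the first vertex of this copy only: that
    -- vertex has rank 0 and the rest of the copy hangs from it.
    kind 1F = hung false 0 (mid 0F)
    kind 2F = core
    kind 3F = hung false 1 (mid 0F)

    hangs : Hanging kind (λ _ → 0) mid
    hangs 0F = (tt , λ ()) , (inj₁ (refl , inj₂ (inj₁ refl)) , λ ())
    hangs 1F = (inj₁ (refl , inj₂ (inj₁ refl)) , λ ()) , (tt , λ ())
    hangs 2F = (tt , λ ()) , (tt , λ ())

    slim : ∀ i → Slim (kind i) i
    slim 0F = λ { false → s≤s z≤n ; true → s≤s z≤n }
    slim 1F = s≤s (s≤s z≤n)
    slim 2F = λ { false → s≤s z≤n ; true → s≤s z≤n }
    slim 3F = tt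

    lengths : ∀ H → suc H + (1 + (suc H + (1 + (1 + (1 + 0))))) ≡ 2 * (H + 3)
    lengths = solve-∀

    cover : ∀ v → nodeRank kind (λ _ → 0) mid v ≡ 0 → ∃ λ C → C ∈ blocks × v ∈ blockPoints C
    cover (copy 0F p) _    = _ , here refl , ∈-run false 0F p
    cover (copy 1F p) rank = _ , there (there (there (there (here refl)))) , here (cong (copy 1F) (dist-0 false rank))
    cover (copy 2F p) _    = _ , there (there (here refl)) , ∈-run true 2F p
    cover (copy 3F p) ()
    cover (mid 0F)    _    = _ , there (there (there (there (there (here refl))))) , here refl
    cover (mid 1F)    _    = _ , there (there (there (here refl))) , here refl
    cover (mid 2F)    _    = _ , there (here refl) , here refl

  digon-count : ∀ ℓ → CircuitCount (graph-of digon digon-proper) ℓ (exactly (2 * (H + 2)) ℓ)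
  digon-count = necklace-count
      (leave false 0F 2F _ ∷ enter true 1F 2F _ ∷ leave true 1F 0F _ ∷ [ _ ])
      (enter false 0F 0F _)
      (from-yes (unique-tags? (map blockTag blocks)))
      (lengths H) (ℕₚ.≤-trans (ℕₚ.+-monoˡ-≤ 2 0<H) (ℕₚ.m≤m+n (H + 2) _)) hangs slim cover
    where
    open Digon

    blocks : List Block
    blocks = run false 0F ∷ single (mid 2F) ∷ run true 1F ∷ single (mid 0F) ∷ []

    kind : Fin 6 → Kind
    kind 0F = core
    kind 1F = core
    -- Each of the two trees is rooted at its new vertex, of rank 1, so its copies start at rank 2.
    kind 2F = hung false 2 (mid 1F)
    kind 3F = hung false 2 (mid 1F)
    kind 4F = hung true 2 (mid 3F)
    kind 5F = hung true 2 (mid 3F)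

    midRank : Fin 4 → ℕ
    midRank 0F = 0
    midRank 1F = 1
    midRank 2F = 0
    midRank 3F = 1

    hangs : Hanging kind midRank mid
    hangs 0F = (tt , λ ()) , (tt , λ ())
    hangs 1F = (inj₁ (refl , inj₁ refl) , λ _ → inj₂ (s≤s (s≤s z≤n)))
             , (inj₁ (refl , inj₁ refl) , λ _ → inj₂ (s≤s (s≤s z≤n)))
    hangs 2F = (tt , λ ()) , (tt , λ ())
    hangs 3F = (inj₁ (refl , inj₁ refl) , λ _ → inj₂ (s≤s (s≤s z≤n)))
             , (inj₁ (refl , inj₁ refl) , λ _ → inj₂ (s≤s (s≤s z≤n)))

    slim : ∀ i → Slim (kind i) i
    slim 0F = λ { false → s≤s z≤n ; true → s≤s z≤n }
    slim 1F = λ { false → s≤s z≤n ; true → s≤s z≤n }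
    slim 2F = tt
    slim 3F = tt
    slim 4F = tt
    slim 5F = tt

    lengths : ∀ H → suc H + (1 + (suc H + (1 + 0))) ≡ 2 * (H + 2)
    lengths = solve-∀

    cover : ∀ v → nodeRank kind midRank mid v ≡ 0 → ∃ λ C → C ∈ blocks × v ∈ blockPoints C
    cover (copy 0F p) _ = _ , here refl , ∈-run false 0F p
    cover (copy 1F p) _ = _ , there (there (here refl)) , ∈-run true 1F p
    cover (copy 2F p) ()
    cover (copy 3F p) ()
    cover (copy 4F p) ()
    cover (copy 5F p) ()
    cover (mid 0F)    _ = _ , there (there (there (here refl))) , here refl
    cover (mid 2F)    _ = _ , there (here refl) , here refl
    cover (mid 1F) ()
    cover (mid 3F) ()

  square-count : ∀ ℓ → CircuitCount (graph-of square square-proper) ℓ (exactly (4 * (H + 2)) ℓ)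
  square-count = necklace-count
      (leave false 0F 3F _ ∷ enter true 3F 3F _ ∷ leave true 3F 1F _ ∷ enter false 2F 1F _ ∷
       leave false 2F 2F _ ∷ enter true 1F 2F _ ∷ leave true 1F 0F _ ∷ [ _ ])
      (enter false 0F 0F _)
      (from-yes (unique-tags? (map blockTag blocks)))
      (lengths H) (ℕₚ.≤-trans (ℕₚ.+-monoˡ-≤ 2 0<H) (ℕₚ.m≤m+n (H + 2) _)) hangs slim cover
    where
    open Square

    blocks : List Block
    blocks = run false 0F ∷ single (mid 3F) ∷ run true 3F ∷ single (mid 1F) ∷
             run false 2F ∷ single (mid 2F) ∷ run true 1F ∷ single (mid 0F) ∷ []

    kind : Fin 6 → Kind
    kind 0F = core
    kind 1F = core
    kind 2F = core
    kind 3F = core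
    kind 4F = hung false 1 (mid 0F)
    kind 5F = hung false 1 (mid 0F)

    hangs : Hanging kind (λ _ → 0) mid
    hangs 0F = (tt , λ ()) , (tt , λ ())
    hangs 1F = (tt , λ ()) , (tt , λ ())
    hangs 2F = (tt , λ ()) , (tt , λ ())
    hangs 3F = (tt , λ ()) , (tt , λ ())

    slim : ∀ i → Slim (kind i) i
    slim 0F = λ { false → s≤s z≤n ; true → s≤s z≤n }
    slim 1F = λ { false → s≤s z≤n ; true → s≤s z≤n }
    slim 2F = λ { false → s≤s z≤n ; true → s≤s z≤n }
    slim 3F = λ { false → s≤s z≤n ; true → s≤s z≤n }
    slim 4F = tt
    slim 5F = tt

    lengths : ∀ H → suc H + (1 + (suc H + (1 + (suc H + (1 + (suc H + (1 + 0))))))) ≡ 4 * (H + 2)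
    lengths = solve-∀

    cover : ∀ v → nodeRank kind (λ _ → 0) mid v ≡ 0 → ∃ λ C → C ∈ blocks × v ∈ blockPoints C
    cover (copy 0F p) _ = _ , here refl , ∈-run false 0F p
    cover (copy 1F p) _ = _ , there (there (there (there (there (there (here refl)))))) , ∈-run true 1F p
    cover (copy 2F p) _ = _ , there (there (there (there (here refl)))) , ∈-run false 2F p
    cover (copy 3F p) _ = _ , there (there (here refl)) , ∈-run true 3F p
    cover (copy 4F p) ()
    cover (copy 5F p) ()
    cover (mid 0F)    _ = _ , there (there (there (there (there (there (there (here refl))))))) , here refl
    cover (mid 1F)    _ = _ , there (there (there (here refl))) , here refl
    cover (mid 2F)    _ = _ , there (there (there (there (there (here refl))))) , here refl
    cover (mid 3F)    _ = _ , there (here refl) , here refl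

  star-count : ∀ ℓ → CircuitCount (graph-of star star-proper) ℓ 0
  star-count ℓ = Pruning.forest-count (pruning kind midRank midParent hangs) positive
    where
    open Star
    open Wired H 0<H even star using (Node)

    kind : Fin 4 → Kind
    -- The ranks grow with the distance from the root `mid 2F`, of rank 1. Copy `0F` runs from rank
    -- 2 to `2 + H`, the new vertices at its far end have rank `3 + H`, and the outer copies start
    -- at `4 + H`.
    kind 0F = hung true 2 (mid 2F)
    kind 1F = hung false (4 + H) (mid 0F)
    kind 2F = hung false (4 + H) (mid 1F)
    kind 3F = hung true 2 (mid 2F)

    midRank : Fin 3 → ℕ
    midRank 0F = 3 + H
    midRank 1F = 3 + H
    midRank 2F = 1

    midParent : Fin 3 → Node
    midParent _ = copy 0F (term false)

    hangs : Hanging kind midRank midParent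
    hangs 0F = (inj₂ (refl , ℕₚ.≤-refl) , λ _ → inj₁ refl)
             , (inj₁ (refl , inj₁ refl) , λ _ → inj₂ (ℕₚ.m≤m+n (4 + H) _))
    hangs 1F = (inj₂ (refl , ℕₚ.≤-refl) , λ _ → inj₁ refl)
             , (inj₁ (refl , inj₁ refl) , λ _ → inj₂ (ℕₚ.m≤m+n (4 + H) _))
    hangs 2F = (inj₁ (refl , inj₁ refl) , λ _ → inj₂ (s≤s (s≤s z≤n)))
             , (inj₁ (refl , inj₁ refl) , λ _ → inj₂ (s≤s (s≤s z≤n)))

    positive : ∀ v → 0 < nodeRank kind midRank midParent v
    positive (copy 0F p) = s≤s z≤n
    positive (copy 1F p) = s≤s z≤n
    positive (copy 2F p) = s≤s z≤n
    positive (copy 3F p) = s≤s z≤n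
    positive (mid 0F)    = s≤s z≤n
    positive (mid 1F)    = s≤s z≤n
    positive (mid 2F)    = s≤s z≤n

  triangle~star : graph-of triangle triangle-proper ~ graph-of star star-proper
  triangle~star = ~-sym (Rewire.transplant-~ H 0<H even star-triangle)

  digon~square : graph-of digon digon-proper ~ graph-of square square-proper
  digon~square = ~-sym (Rewire.transplant-~ H 0<H even square-digon)

  triangle-star : DegreeMatching (graph-of triangle triangle-proper) (graph-of star star-proper)
  triangle-star = Rebalance.permute-match H 0<H even {c = triangle} {star} π
    (λ { false → from-yes (Finₚ.all? λ i → π false (π false i) Finₚ.≟ i)
       ; true → from-yes (Finₚ.all? λ i → π true (π true i) Finₚ.≟ i) })
    (λ { false → from-yes (Finₚ.all? λ i → length (midsAt star false (π false i))
          ℕₚ.≟ length (midsAt triangle false i))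
       ; true → from-yes (Finₚ.all? λ i → length (midsAt star true (π true i))
             ℕₚ.≟ length (midsAt triangle true i)) })
    where
    π : Bool → Fin 4 → Fin 4
    -- At the ends `false`, two new vertices meet copy `1F` in the triangle and copy `0F` in the
    -- star; at the ends `true`, copy `0F` is joined to `2F` in the triangle and to `3F` in the
    -- star.
    π false = swap 0F 1F
    π true  = swap 2F 3F

  digon-square : DegreeMatching (graph-of digon digon-proper) (graph-of square square-proper)
  digon-square = Rebalance.permute-match H 0<H even {c = digon} {square} π
    (λ { false → λ _ → refl
       ; true → from-yes (Finₚ.all? λ i → π true (π true i) Finₚ.≟ i) })
    (λ { false → from-yes (Finₚ.all? λ i → length (midsAt square false (π false i))
          ℕₚ.≟ length (midsAt digon false i))
       ; true → from-yes (Finₚ.all? λ i → length (midsAt square true (π true i))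
             ℕₚ.≟ length (midsAt digon true i)) })
    where
    π : Bool → Fin 6 → Fin 6
    π false = id
    π true  = swap 2F 4F ∘ swap 3F 5F

-- The ends of the second copy have degree 1, its inner vertices degree 2.
loop-uneven : ∀ h (0<H : 0 < 3 + h) (even : parity (3 + h) ≡ false) →
  Uneven (Wired.wired (3 + h) 0<H even loop loop-proper)
loop-uneven h 0<H even = copy 1F 1F , copy 1F 0F , copy 1F 2F
  , joined⁺ (along false {p = 1F} {0F} refl)
  , joined⁺ (along true {p = 1F} {2F} (dist-not false {p = 2F} {1F} refl))
  , λ eq → contradiction (trans (sym degree-0) (trans eq degree-2)) λ ()
  where
  open Wired (3 + h) 0<H even loop

  degree-0 : length (wiredNbrs (copy 1F 0F)) ≡ 1
  degree-0 = trans (wired-degree 1F 0F) (cong (_+ 0) (toward-length {3 + h} true 0F))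

  degree-2 : length (wiredNbrs (copy 1F 2F)) ≡ 2
  degree-2 = trans (wired-degree 1F 2F) (cong (λ n → suc n + 0) (toward-length {3 + h} true 2F))

-- Cospectral pairs

exactly-≡ : ∀ {ℓ n : ℕ} → ℓ ≡ n → exactly n ℓ ≡ 1
exactly-≡ {ℓ} {n} ℓ≡n = cong (λ b → if b then 1 else 0) (dec-true (ℓ ℕₚ.≟ n) ℓ≡n)

exactly-< : ∀ {ℓ n : ℕ} → ℓ < n → exactly n ℓ ≡ 0
exactly-< {ℓ} {n} ℓ<n = cong (λ b → if b then 1 else 0) (dec-false (ℓ ℕₚ.≟ n) (ℕₚ.<⇒≢ ℓ<n))

record Mates : Set₁ where
  field
    X Y     : Bigraph
    similar : X ~ Y
    matched : DegreeMatching X Y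
    #X #Y   : ℕ → ℕ
    X-count : ∀ ℓ → CircuitCount X ℓ (#X ℓ)
    Y-count : ∀ ℓ → CircuitCount Y ℓ (#Y ℓ)

open Mates

_⊞_ : Mates → Mates → Mates
M ⊞ N = record
  { X = X M ⊕ X N ; Y = Y M ⊕ Y N
  ; similar = ⊕-~ (similar M) (similar N)
  ; matched = ⊕-match (matched M) (matched N)
  ; #X = λ ℓ → #X M ℓ + #X N ℓ ; #Y = λ ℓ → #Y M ℓ + #Y N ℓ
  ; X-count = λ ℓ → ⊕-count (X-count M ℓ) (X-count N ℓ)
  ; Y-count = λ ℓ → ⊕-count (Y-count M ℓ) (Y-count N ℓ)
  }

record Separating (ℓ : ℕ) (M : Mates) : Set where
  field
    x-first : #X M ℓ ≡ 1
    y-none  : #Y M ℓ ≡ 0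
    shorter : ∀ {m} → m < ℓ → #X M m ≡ 0 × #Y M m ≡ 0

-- Half the target length is `H + 3` for the triangle and `H + 2` for the digon, and the parity of
-- `u` decides which of them leaves `H` even. For `u` equal to 3 the triangle would need `H` to be
-- 0, whence the bound 4. The cycle of the square is twice as long as that of the digon, so it is
-- not seen at length `2 * u`.
separating-mates : ∀ u → 4 ≤ u → ∃ (Separating (2 * u))
separating-mates (suc (suc (suc h))) (s≤s (s≤s (s≤s 0<h))) with parity h in eq
... | true = record
  { X = graph-of digon digon-proper ; Y = graph-of square square-proper
  ; similar = digon~square ; matched = digon-square
  ; #X = exactly (2 * (suc h + 2)) ; #Y = exactly (4 * (suc h + 2)) ; X-count = digon-count ; Y-count = square-count }
  , record
  { x-first = exactly-≡ u≡
  ; y-none  = exactly-< 2u<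
  ; shorter = λ m< → exactly-< (ℕₚ.<-≤-trans m< (ℕₚ.≤-reflexive u≡)) , exactly-< (ℕₚ.<-trans m< 2u<) }
  where
  open Shapes (suc h) (s≤s z≤n) (cong not eq)

  u≡ : 2 * (3 + h) ≡ 2 * (suc h + 2)
  u≡ = cong (2 *_) (ℕₚ.+-comm 2 (suc h))

  2u< : 2 * (3 + h) < 4 * (suc h + 2)
  2u< = subst (_< 4 * (suc h + 2)) (sym u≡) (ℕₚ.*-monoˡ-< (suc h + 2) {2} {4} (s≤s (s≤s (s≤s z≤n))))
... | false = record
  { X = graph-of triangle triangle-proper ; Y = graph-of star star-proper
  ; similar = triangle~star ; matched = triangle-star
  ; #X = exactly (2 * (h + 3)) ; #Y = λ _ → 0 ; X-count = triangle-count ; Y-count = star-count }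
  , record
  { x-first = exactly-≡ u≡
  ; y-none  = refl
  ; shorter = λ m< → exactly-< (ℕₚ.<-≤-trans m< (ℕₚ.≤-reflexive u≡)) , refl }
  where
  open Shapes h 0<h eq

  u≡ : 2 * (3 + h) ≡ 2 * (h + 3)
  u≡ = cong (2 *_) (ℕₚ.+-comm 3 h)

-- Separating all even lengths up to a bound

record Separated (g u : ℕ) (M : Mates) : Set where
  field
    X-uneven : Uneven (X M)
    Y-uneven : Uneven (Y M)
    girth-x  : #X M g ≡ 1
    girth-y  : #Y M g ≡ 1
    shorter  : ∀ {ℓ} → ℓ < g → #X M ℓ ≡ 0 × #Y M ℓ ≡ 0
    -- The bound is exclusive: `u` is half of the first length still to be treated.
    differ   : ∀ t → g < 2 * t → t < u → #X M (2 * t) ≢ #Y M (2 * t)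

loop-mates : ∀ k → 1 ≤ k → ∃ (Separated (4 * k + 2) (2 * k + 2))
loop-mates (suc k) _ = record
  { X = L ; Y = L ; similar = ~-refl ; matched = match-refl
  ; #X = exactly (H + 2) ; #Y = exactly (H + 2) ; X-count = loop-count ; Y-count = loop-count }
  , record
  { X-uneven = loop-uneven h (s≤s z≤n) even
  ; Y-uneven = loop-uneven h (s≤s z≤n) even
  ; girth-x = exactly-≡ g≡
  ; girth-y = exactly-≡ g≡
  ; shorter = λ ℓ< → exactly-< (ℕₚ.<-≤-trans ℓ< (ℕₚ.≤-reflexive g≡)) , exactly-< (ℕₚ.<-≤-trans ℓ< (ℕₚ.≤-reflexive g≡))
  -- Nothing lies in this range yet: `g` is twice `u - 1`, so no `t` below `u` has `2 * t` above
  -- `g`.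
  ; differ  = λ t g< t< → contradiction (ℕₚ.*-monoʳ-≤ 2 (ℕₚ.≤-pred (subst (t <_) (2k+2 k) t<)))
                (ℕₚ.<⇒≱ (subst (_< 2 * t) (4k+2 k) g<)) }
  where
  h H : ℕ
  -- `H` is four times the original `k`, two less than the girth. It is split off as `3 + h` because
  -- `loop-uneven` names the positions 0, 1 and 2 on the path.
  h = 1 + 4 * k
  H = 3 + h

  4* : ∀ k → 4 * suc k ≡ 4 + 4 * k
  4* = solve-∀

  parity-4+ : ∀ n → parity (4 + n) ≡ parity n
  parity-4+ n = trans (not-involutive (not (not (parity n)))) (not-involutive (parity n))

  parity-4* : ∀ k → parity (4 * k) ≡ false
  parity-4* zero    = refl
  parity-4* (suc k) = trans (cong parity (4* k)) (trans (parity-4+ (4 * k)) (parity-4* k))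

  even : parity H ≡ false
  even = trans (parity-4+ (4 * k)) (parity-4* k)

  open Shapes H (s≤s z≤n) even

  L : Bigraph
  L = graph-of loop loop-proper

  g≡ : 4 * suc k + 2 ≡ H + 2
  g≡ = cong (_+ 2) (4* k)

  2k+2 : ∀ k → 2 * suc k + 2 ≡ suc (2 * suc k + 1)
  2k+2 = solve-∀

  4k+2 : ∀ k → 4 * suc k + 2 ≡ 2 * (2 * suc k + 1)
  4k+2 = solve-∀

-- The added pair has no cycle shorter than `2 * u`. As `g` is below that, the girth, its unique
-- cycle and all differences found so far survive; unevenness is inherited from the left summand.
extend : ∀ {g u} → 4 ≤ u → g < 2 * u → ∃ (Separated g u) → ∃ (Separated g (suc u))
extend {g} {u} 4≤u g<2u (M , S) with #X M (2 * u) ℕₚ.≟ #Y M (2 * u)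
... | no x≢y = M , record { Separated S ; differ = differ′ }
  where
  open Separated S

  differ′ : ∀ t → g < 2 * t → t < suc u → #X M (2 * t) ≢ #Y M (2 * t)
  differ′ t g< (s≤s t≤u) with ℕₚ.m≤n⇒m<n∨m≡n t≤u
  ... | inj₁ t<u  = differ t g< t<u
  ... | inj₂ refl = x≢y
... | yes x≡y = let N , Q = separating-mates u 4≤u in M ⊞ N , sum-separated N Q
  where
  open Separated S

  sum-separated : ∀ N → Separating (2 * u) N → Separated g (suc u) (M ⊞ N)
  sum-separated N Q = record
    { X-uneven = ⊕-uneven {X M} {X N} X-uneven
    ; Y-uneven = ⊕-uneven {Y M} {Y N} Y-uneven
    ; girth-x  = cong₂ _+_ girth-x (proj₁ (Q.shorter g<2u))
    ; girth-y  = cong₂ _+_ girth-y (proj₂ (Q.shorter g<2u))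
    ; shorter  = λ ℓ<g → cong₂ _+_ (proj₁ (shorter ℓ<g)) (proj₁ (Q.shorter (ℕₚ.<-trans ℓ<g g<2u)))
                       , cong₂ _+_ (proj₂ (shorter ℓ<g)) (proj₂ (Q.shorter (ℕₚ.<-trans ℓ<g g<2u)))
    ; differ   = differ′ }
    where
    module Q = Separating Q

    differ′ : ∀ t → g < 2 * t → t < suc u → #X M (2 * t) + #X N (2 * t) ≢ #Y M (2 * t) + #Y N (2 * t)
    differ′ t g< (s≤s t≤u) eq with ℕₚ.m≤n⇒m<n∨m≡n t≤u
    ... | inj₁ t<u = differ t g< t<u (trans (sym (plus-0 (proj₁ (Q.shorter 2t<))))
      (trans eq (plus-0 (proj₂ (Q.shorter 2t<)))))
      where
      2t< : 2 * t < 2 * u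
      2t< = ℕₚ.*-monoʳ-< 2 t<u

      plus-0 : ∀ {a b} → b ≡ 0 → a + b ≡ a
      plus-0 refl = ℕₚ.+-identityʳ _
    ... | inj₂ refl = ℕₚ.<⇒≢ (ℕₚ.n<1+n 0) (sym (ℕₚ.+-cancelˡ-≡ (#X M (2 * u)) 1 0
      (trans (cong (#X M (2 * u) +_) (sym Q.x-first)) (trans eq (cong₂ _+_ (sym x≡y) Q.y-none)))))

separated : ∀ k → 1 ≤ k → ∀ n → ∃ (Separated (4 * k + 2) (2 * k + 2 + n))
separated k 1≤k zero    = subst (λ u → ∃ (Separated (4 * k + 2) u)) (sym (ℕₚ.+-identityʳ (2 * k + 2)))
  (loop-mates k 1≤k)
separated k 1≤k (suc n) = subst (λ u → ∃ (Separated (4 * k + 2) u)) (sym (ℕₚ.+-suc (2 * k + 2) n))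
  (extend 4≤ girth< (separated k 1≤k n))
  where
  4≤ : 4 ≤ 2 * k + 2 + n
  4≤ = ℕₚ.≤-trans (ℕₚ.+-monoˡ-≤ 2 (ℕₚ.*-monoʳ-≤ 2 1≤k)) (ℕₚ.m≤m+n (2 * k + 2) n)

  shape : ∀ k n → 2 * (2 * k + 2 + n) ≡ suc (4 * k + 2) + (1 + 2 * n)
  shape = solve-∀

  girth< : 4 * k + 2 < 2 * (2 * k + 2 + n)
  girth< = subst (suc (4 * k + 2) ≤_) (sym (shape k n)) (ℕₚ.m≤m+n _ _)

-- Girth, and the assembled pair of graphs

girth : ∀ {X g} {a : ℕ → ℕ} → (∀ ℓ → CircuitCount X ℓ (a ℓ)) → a g ≡ 1 → (∀ {ℓ} → ℓ < g → a ℓ ≡ 0) →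
  HasGirth (graph X) g
girth {X} {g} {a} count one none = cycle (enumerate (subst (CircuitCount X g) one (count g)) zero) ,
  λ ℓ C → ℕₚ.≮⇒≥ λ ℓ<g → Finₚ.¬Fin0 (proj₁ (exhaust (subst (CircuitCount X ℓ) (none ℓ<g) (count ℓ)) (circuit C)))

mainTheorem9 : (j k : ℕ) → 1 ≤ k → k ≤ j →
    ∃₂ λ (F F′ : Graph) →
    HalfRegular F × HalfRegular F′ ×
    SameSpectrum F F′ ×
    SameDegreeSequences F F′ ×
    HasGirth F (4 * k + 2) × HasGirth F′ (4 * k + 2) ×
    NumberOfCycles F (4 * k + 2) 1 × NumberOfCycles F′ (4 * k + 2) 1 ×
    ((ℓ : ℕ) → 2 ∣ ℓ → 4 * k + 2 < ℓ → ℓ ≤ 4 * j + 6 →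
    DifferentNumberOfCycles F F′ ℓ)
-- Half-lengths run from `2 * k + 2` up to `2 * j + 3`, which is half of `4 * j + 6`. That makes
-- `2 * (j ∸ k) + 2` extensions, after which the exclusive bound is `2 * j + 4`.
mainTheorem9 j k 1≤k k≤j = let M , S = separated k 1≤k (2 * (j ∸ k) + 2) in conclude M S
  where
  conclude : ∀ M → Separated (4 * k + 2) (2 * k + 2 + (2 * (j ∸ k) + 2)) M → _
  conclude M S =
      graph (X M) , graph (Y M)
    , halfRegular (X M) X-uneven , halfRegular (Y M) Y-uneven
    , sameSpectrum (similar M)
    , sameDegreeSequences (matched M)
    , girth {a = #X M} (X-count M) girth-x (proj₁ ∘ shorter) , girth {a = #Y M} (Y-count M) girth-y (proj₂ ∘ shorter)
    , numberOfCycles (subst (CircuitCount (X M) (4 * k + 2)) girth-x (X-count M _))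
    , numberOfCycles (subst (CircuitCount (Y M) (4 * k + 2)) girth-y (Y-count M _))
    , λ { .(t * 2) (divides t refl) g< ≤ℓ →
          #X M (t * 2) , #Y M (t * 2) , numberOfCycles (X-count M (t * 2)) , numberOfCycles (Y-count M (t * 2))
        , subst (λ ℓ → #X M ℓ ≢ #Y M ℓ) (ℕₚ.*-comm 2 t)
            (differ t (subst (4 * k + 2 <_) (ℕₚ.*-comm t 2) g<) (bound t (subst (_≤ 4 * j + 6) (ℕₚ.*-comm t 2) ≤ℓ))) }
    where
    open Separated S

    double : ∀ j → 4 * j + 6 ≡ 2 * (2 * j + 3)
    double = solve-∀

    shape : ∀ k d → suc (2 * (d + k) + 3) ≡ 2 * k + 2 + (2 * d + 2)
    shape = solve-∀

    bound : ∀ t → 2 * t ≤ 4 * j + 6 → t < 2 * k + 2 + (2 * (j ∸ k) + 2)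
    bound t ≤ℓ = subst (t <_) (trans (cong (λ i → suc (2 * i + 3)) (sym (ℕₚ.m∸n+n≡m k≤j))) (shape k (j ∸ k)))
      (s≤s (ℕₚ.*-cancelˡ-≤ 2 (subst (2 * t ≤_) (double j) ≤ℓ)))
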